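{- For every integer $a\ge 4$, the spider graph $S(a,4,1)$ is Schur positive, i.e., every coefficient of its chromatic symmetric function $X_{S(a,4,1)}$ in the Schur basis $\{s_\lambda\}$ is nonnegative.
   Context: For a simple graph $G$ with vertex set $\{v_1,v_2,\dots\}$, the chromatic symmetric function is $X_G(x_1,x_2,\dots)=\sum_{c} x_{c(v_1)}x_{c(v_2)}\cdots$, the sum over all proper colorings $c\colon V(G)\to\{1,2,3,\dots\}$. $G$ is Schur positive if all coefficients of $X_G$ in the basis of Schur functions are nonnegative. For a partition $\lambda=(\lambda_1,\lambda_2,\dots)$ of $n-1$, the spider $S(\lambda)$ is the tree on $n$ vertices obtained by taking paths $P_{\lambda_1+1},P_{\lambda_2+1},\dots$ (where $P_m$ is the path on $m$ vertices) and identifying one end vertex of each of them into a single vertex. Thus $S(a,4,1)$ has $a+6$ vertices. -}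

module Defs where

open import Data.Nat using (ℕ; zero; suc; _+_; _*_; _∸_; _≡ᵇ_; _<ᵇ_; _≤ᵇ_)
open import Data.Bool using (Bool; true; false; _∧_; not)
open import Data.List using (List; []; _∷_; [_]; _++_; map; concatMap; filterᵇ; length; upTo; zip; foldr)
open import Data.Nat.ListAction using (sum)
open import Data.Bool.ListAction using (and)
open import Data.List.Relation.Unary.All using (All)
open import Data.Product using (_×_; _,_; Σ; ∃)
open import Relation.Binary.PropositionalEquality using (_≡_)
open import Relation.Nullary.Decidable using (does)
open import Relation.Nullary using (yes; no)

-- Finite simple graphs.  Vertices are 0,1,…,size-1; edges are unordered
-- pairs given as a list.

record Graph : Set where
  field
    size  : ℕ
    edges : List (ℕ × ℕ)
open Graph public

-- Spiders.  For a partition λ = (λ₁,λ₂,…) (given as a list of leg lengths)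
-- S(λ) has centre 0 and, for each i, a leg (path) of λᵢ further vertices
-- attached to the centre, i.e. a path P_{λᵢ+1} whose end vertex is the centre.

-- edges of one leg of length ℓ whose non-centre vertices are o+1,…,o+ℓ
legEdges : ℕ → ℕ → List (ℕ × ℕ)
legEdges o ℓ = map edge (upTo ℓ)
  where
  edge : ℕ → ℕ × ℕ
  edge zero    = (0 , o + 1)
  edge (suc i) = (o + suc i , o + suc (suc i))

spiderEdges : ℕ → List ℕ → List (ℕ × ℕ)
spiderEdges o []       = []
spiderEdges o (ℓ ∷ ls) = legEdges o ℓ ++ spiderEdges (o + ℓ) ls

spider : List ℕ → Graph
spider λs = record { size = suc (sum λs) ; edges = spiderEdges 0 λs }

words : ℕ → ℕ → List (List ℕ)
words m zero    = [ [] ]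
words m (suc k) = concatMap (λ i → map (i ∷_) (words m k)) (upTo m)

-- entry at a position (default 0; only used in range)
at : List ℕ → ℕ → ℕ
at []       _       = 0
at (x ∷ xs) zero    = x
at (x ∷ xs) (suc i) = at xs i

count : ℕ → List ℕ → ℕ
count i w = length (filterᵇ (λ x → x ≡ᵇ i) w)

hasContent : List ℕ → List ℕ → Bool
hasContent α w = and (map (λ p → count (Data.Product.proj₁ p) w ≡ᵇ Data.Product.proj₂ p)
                          (zip (upTo (length α)) α))

-- Chromatic symmetric function, monomial coefficients.
-- A coloring c : V → {0,…,m-1} is a word of length |V|.  For a weak
-- composition α = (α₀,…,α_{m-1}) the coefficient of x^α in X_G is the
-- number of proper colorings with color i used exactly α_i times.

proper : List (ℕ × ℕ) → List ℕ → Bool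
proper es c = and (map (λ e → not (at c (Data.Product.proj₁ e) ≡ᵇ at c (Data.Product.proj₂ e))) es)

chromCoeff : Graph → List ℕ → ℕ
chromCoeff G α =
  length (filterᵇ (λ c → proper (edges G) c ∧ hasContent α c)
                 (words (length α) (size G)))

-- Partitions of n: weakly decreasing lists of positive integers summing to n.
-- partsF fuel n k = partitions of n with all parts ≤ k (fuel ≥ n suffices).

partsF : ℕ → ℕ → ℕ → List (List ℕ)
partsF _        zero    _ = [ [] ]
partsF zero     (suc n) _ = []
partsF (suc f)  (suc n) k =
  concatMap (λ j → map (suc j ∷_) (partsF f (n ∸ j) (suc j)))
            (filterᵇ (λ j → j <ᵇ k) (upTo (suc n)))

partitions : ℕ → List (List ℕ)
partitions n = partsF n n n

-- Schur functions via semistandard Young tableaux: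
-- coefficient of x^α in s_λ = number of SSYT of shape λ and content α.
-- A filling of shape λ with entries in {0,…,m-1} is a list of rows.

fillings : ℕ → List ℕ → List (List (List ℕ))
fillings m []       = [ [] ]
fillings m (r ∷ rs) = concatMap (λ row → map (row ∷_) (fillings m rs)) (words m r)

weaklyInc : List ℕ → Bool
weaklyInc []           = true
weaklyInc (x ∷ [])     = true
weaklyInc (x ∷ y ∷ xs) = (x ≤ᵇ y) ∧ weaklyInc (y ∷ xs)

strictBelow : List ℕ → List ℕ → Bool
strictBelow upper lower =
  and (map (λ p → Data.Product.proj₁ p <ᵇ Data.Product.proj₂ p) (zip upper lower))

columnsStrict : List (List ℕ) → Bool
columnsStrict []            = true
columnsStrict (r ∷ [])      = true
columnsStrict (r ∷ s ∷ rs)  = strictBelow r s ∧ columnsStrict (s ∷ rs)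

isSSYT : List (List ℕ) → Bool
isSSYT T = and (map weaklyInc T) ∧ columnsStrict T

concatRows : List (List ℕ) → List ℕ
concatRows = foldr _++_ []

kostka : List ℕ → List ℕ → ℕ
kostka λs α =
  length (filterᵇ (λ T → isSSYT T ∧ hasContent α (concatRows T))
                 (fillings (length α) λs))

-- Schur positivity: X_G = Σ_{λ ⊢ |V|} c_λ s_λ with all c_λ ∈ ℕ, i.e. for
-- every monomial x^α (α a weak composition of |V| of any length m)
-- the coefficients agree.

SchurPositive : Graph → Set
SchurPositive G =
  Σ (List ℕ → ℕ) λ c →
    (α : List ℕ) → sum α ≡ size G →
      chromCoeff G α ≡ sum (map (λ λs → c λs * kostka λs α) (partitions (size G)))

{-# OPTIONS --safe #-}
module Submission where

-- Let Pₙ be the chromatic symmetric function of the path on n vertices and Xₐ that of S(a,4,1).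
-- Deleting one colour at a time gives Pₙ₊₁ = eₙ₊₁ + ∑ⱼ j eⱼ₊₁ Pₙ₋ⱼ, and comparing S(a,4,1) with
-- disjoint unions of paths gives Xₐ + P₅ Pₐ₊₁ = Pₐ₊₆ + e₁ Pₐ₊₅.  So Xₐ satisfies a recursion
-- with nonnegative coefficients in the eₖ, except for one term − P₅ eₐ₊₁.  For a ≥ 2 it is
-- absorbed by the term a eₐ₊₁ e₁ P₄, as 2 e₁ P₄ − P₅ = 5 s₂₁₁₁ + 3 e₂ s₂₁ + 4 e₃ s₂; the cases
-- a = 0, 1 are explicit.  Hence Xₐ is a nonnegative combination of products of eₖ's with hook
-- Schur functions, which are Schur positive by the dual Pieri rule.  That rule follows by
-- induction on the number of variables: removing a horizontal strip and adding a vertical one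
-- commute up to a factor 1 + q.
--
-- All identities live in a semiring with cancellative addition (polynomials over ℕ), so terms
-- are moved across equations instead of being subtracted.

-- A coefficient at a content of length m sees only m variables, while one choice of multiplicities
-- must serve every m. So all polynomials carry m as a parameter, and positivity is certified by a
-- list of shapes chosen before m.
--
-- Origin of the negative term: the path recursion is inserted for Pₐ₊₆, Pₐ₊₅ and Pₐ₊₁. The three
-- convolutions recombine into smaller spiders, but the inhomogeneous eₐ₊₁ of Pₐ₊₁, multiplied by
-- P₅, finds no partner. Read at a = -1, the relation between spiders and paths puts e₁ P₄ in the
-- place of X₋₁; this is how e₁ P₄ gets the coefficient a eₐ₊₁. Products of eₖ's alone do not
-- suffice for the absorption: 5 e₅ and 7 e₃ e₂ in P₅ have no counterpart in 2 e₁ P₄ = 8 e₄ e₁ + 4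
-- e₂ e₂ e₁ + 4 e₃ e₁ e₁. They appear only after rewriting eₖ₊₁ e₁ as eₖ₊₂ plus the Schur function
-- of (2, 1ᵏ), hence the hooks.
--
-- Shapes are padded with zeros to a fixed number N of rows larger than the degree, so that a
-- vertical strip always fits into the existing rows. Strips may then be added blindly row by row,
-- since lists that are not weakly decreasing have Schur polynomial 0.

open import Defs
open import Algebra.Bundles using (CommutativeSemiring)
open import Algebra.Definitions using (LeftCancellative)
open import Algebra.Structures.Biased using (isCommutativeSemiringˡ)
open import Data.Bool using (Bool; true; false; _∧_; not; if_then_else_; T)
open import Data.Bool.ListAction using (and)
open import Data.Bool.Properties using (∧-assoc; ∧-zeroʳ)
open import Data.Empty using (⊥-elim)
open import Data.List using (List; []; _∷_; [_]; _++_; map; concatMap; filterᵇ; foldr; length; replicate; upTo; applyUpTo; zip)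
open import Data.List.Properties using (++-assoc; ++-identityʳ; length-++; length-replicate; map-applyUpTo; map-upTo)
open import Data.List.Relation.Unary.All as All using (All; []; _∷_)
open import Data.List.Relation.Unary.All.Properties using (++⁺; map⁺)
open import Data.List.Relation.Unary.Any using (Any; here; there)
open import Data.Nat as ℕ using (ℕ; zero; suc; _∸_; _≤_; _<_; z≤n; s≤s; s≤s⁻¹; z<s; s<s; s<s⁻¹; _≡ᵇ_; _≤ᵇ_; _<ᵇ_; _≤?_; _<?_)
open import Data.Nat.Induction using (<-rec)
open import Data.Nat.ListAction using (sum)
open import Data.Nat.Properties as ℕₚ using (≤ᵇ⇒≤; ≤⇒≤ᵇ; ≤-trans; ≤-refl; <⇒≤; n<1+n; m≤n⇒m≤1+n; m<1+n⇒m<n∨m≡n; <-cmp; <⇒≱; ≮⇒≥; +-*-commutativeSemiring)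
open import Data.Product using (Σ; ∃; _,_; proj₁; proj₂) renaming (_×_ to _&_)
open import Data.Sum using (_⊎_; inj₁; inj₂)
open import Data.Unit using (tt)
open import Function using (_∘_; id)
open import Level using (0ℓ)
open import Relation.Binary.Definitions using (tri<; tri≈; tri>)
open import Relation.Binary.PropositionalEquality as ≡ using (_≡_)
open import Relation.Binary.Structures using (IsEquivalence)
open import Relation.Nullary using (¬_; Dec; yes; no)

-- Sums over lists

module ListSum {c ℓ} (R : CommutativeSemiring c ℓ) where
  open CommutativeSemiring R hiding (zero)
  open import Relation.Binary.Reasoning.Setoid setoid
  open import Algebra.Properties.CommutativeSemigroup +-commutativeSemigroup
    using (interchange)
  open import Algebra.Properties.Semiring.Mult semiring public
    using (_×_; ×-congʳ; ×-comm-*; ×-assoc-*)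

  private variable
    A B : Set

  ∑ : List A → (A → Carrier) → Carrier
  ∑ []       f = 0#
  ∑ (a ∷ as) f = f a + ∑ as f

  when : Bool → Carrier → Carrier
  when b r = if b then r else 0#

  when-cong : ∀ b {r s} → (b ≡ true → r ≈ s) → when b r ≈ when b s
  when-cong true  r≈s = r≈s ≡.refl
  when-cong false _   = refl

  when-≡ : ∀ {a b r} → a ≡ b → when a r ≈ when b r
  when-≡ ≡.refl = refl

  when-true : ∀ {b r} → b ≡ true → when b r ≈ r
  when-true ≡.refl = refl

  when-false : ∀ {b r} → b ≡ false → when b r ≈ 0#
  when-false ≡.refl = refl

  when-∧ : ∀ a b {r} → when (a ∧ b) r ≈ when a (when b r)
  when-∧ true  b = refl
  when-∧ false b = refl

  when-comm : ∀ a b {r} → when a (when b r) ≈ when b (when a r)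
  when-comm true  b     = refl
  when-comm false true  = refl
  when-comm false false = refl

  when-0 : ∀ b → when b 0# ≈ 0#
  when-0 true  = refl
  when-0 false = refl

  *-when : ∀ b {r s} → r * when b s ≈ when b (r * s)
  *-when true  = refl
  *-when false = zeroʳ _

  when-+ : ∀ b {r s} → when b (r + s) ≈ when b r + when b s
  when-+ true  = refl
  when-+ false = sym (+-identityˡ 0#)

  ∑-All : ∀ {P : A → Set} {as} {f g : A → Carrier} → All P as →
          (∀ a → P a → f a ≈ g a) → ∑ as f ≈ ∑ as g
  ∑-All []         f≈g = refl
  ∑-All (pa ∷ pas) f≈g = +-cong (f≈g _ pa) (∑-All pas f≈g)

  ∑-cong : ∀ as {f g : A → Carrier} → (∀ a → f a ≈ g a) → ∑ as f ≈ ∑ as g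
  ∑-cong []       f≈g = refl
  ∑-cong (a ∷ as) f≈g = +-cong (f≈g a) (∑-cong as f≈g)

  ∑-0 : ∀ (as : List A) → ∑ as (λ _ → 0#) ≈ 0#
  ∑-0 []       = refl
  ∑-0 (a ∷ as) = trans (+-identityˡ _) (∑-0 as)

  ∑-++ : ∀ as {bs} {f : A → Carrier} → ∑ (as ++ bs) f ≈ ∑ as f + ∑ bs f
  ∑-++ []       = sym (+-identityˡ _)
  ∑-++ (a ∷ as) = trans (+-congˡ (∑-++ as)) (sym (+-assoc _ _ _))

  ∑-map : ∀ (g : B → A) bs {f : A → Carrier} → ∑ (map g bs) f ≈ ∑ bs (f ∘ g)
  ∑-map g []       = refl
  ∑-map g (b ∷ bs) = +-congˡ (∑-map g bs)

  ∑-concatMap : ∀ (g : B → List A) bs {f : A → Carrier} →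
                ∑ (concatMap g bs) f ≈ ∑ bs (λ b → ∑ (g b) f)
  ∑-concatMap g []       = refl
  ∑-concatMap g (b ∷ bs) = trans (∑-++ (g b)) (+-congˡ (∑-concatMap g bs))

  ∑-filter : ∀ (p : A → Bool) as {f : A → Carrier} →
             ∑ (filterᵇ p as) f ≈ ∑ as (λ a → when (p a) (f a))
  ∑-filter p []       = refl
  ∑-filter p (a ∷ as) with p a
  ... | true  = +-congˡ (∑-filter p as)
  ... | false = trans (∑-filter p as) (sym (+-identityˡ _))

  ∑-+ : ∀ as {f g : A → Carrier} → ∑ as (λ a → f a + g a) ≈ ∑ as f + ∑ as g
  ∑-+ []       = sym (+-identityˡ 0#)
  ∑-+ (a ∷ as) = trans (+-congˡ (∑-+ as)) (interchange _ _ _ _)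

  *-∑ : ∀ r as {f : A → Carrier} → r * ∑ as f ≈ ∑ as (λ a → r * f a)
  *-∑ r []       = zeroʳ r
  *-∑ r (a ∷ as) = trans (distribˡ _ _ _) (+-congˡ (*-∑ r as))

  ∑-* : ∀ as {f : A → Carrier} r → ∑ as f * r ≈ ∑ as (λ a → f a * r)
  ∑-* []       r = zeroˡ r
  ∑-* (a ∷ as) r = trans (distribʳ _ _ _) (+-congˡ (∑-* as r))

  when-∑ : ∀ b as {f : A → Carrier} → when b (∑ as f) ≈ ∑ as (λ a → when b (f a))
  when-∑ true  as = refl
  when-∑ false as = sym (∑-0 as)

  ∑-swap : ∀ (as : List A) (bs : List B) {f : A → B → Carrier} →
           ∑ as (λ a → ∑ bs (f a)) ≈ ∑ bs (λ b → ∑ as (λ a → f a b))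
  ∑-swap []       bs = sym (∑-0 bs)
  ∑-swap (a ∷ as) bs = trans (+-congˡ (∑-swap as bs)) (sym (∑-+ bs))

  ∑< : ℕ → (ℕ → Carrier) → Carrier
  ∑< n = ∑ (upTo n)

  ∑<-first : ∀ n {f} → ∑< (suc n) f ≈ f 0 + ∑< n (f ∘ suc)
  ∑<-first n {f} = +-congˡ (begin
    ∑ (applyUpTo suc n) f  ≡⟨ ≡.cong (λ as → ∑ as f) (map-upTo suc n) ⟨
    ∑ (map suc (upTo n)) f ≈⟨ ∑-map suc (upTo n) ⟩
    ∑< n (f ∘ suc)         ∎)

  ∑<-cong : ∀ n {f g} → (∀ i → i < n → f i ≈ g i) → ∑< n f ≈ ∑< n g
  ∑<-cong zero    f≈g = refl
  ∑<-cong (suc n) {f} {g} f≈g = begin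
    ∑< (suc n) f         ≈⟨ ∑<-first n ⟩
    f 0 + ∑< n (f ∘ suc) ≈⟨ +-cong (f≈g 0 z<s) (∑<-cong n (λ i i<n → f≈g (suc i) (s<s i<n))) ⟩
    g 0 + ∑< n (g ∘ suc) ≈⟨ ∑<-first n ⟨
    ∑< (suc n) g         ∎

  ∑<-last : ∀ n {f} → ∑< (suc n) f ≈ ∑< n f + f n
  ∑<-last zero    = +-comm _ _
  ∑<-last (suc n) {f} = begin
    ∑< (suc (suc n)) f                     ≈⟨ ∑<-first (suc n) ⟩
    f 0 + ∑< (suc n) (f ∘ suc)             ≈⟨ +-congˡ (∑<-last n) ⟩
    f 0 + (∑< n (f ∘ suc) + f (suc n))     ≈⟨ +-assoc _ _ _ ⟨
    f 0 + ∑< n (f ∘ suc) + f (suc n)       ≈⟨ +-congʳ (∑<-first n) ⟨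
    ∑< (suc n) f + f (suc n)               ∎

  ∑-words : ∀ m k {f} → ∑ (words m (suc k)) f ≈ ∑< m (λ i → ∑ (words m k) (f ∘ (i ∷_)))
  ∑-words m k = trans (∑-concatMap _ (upTo m))
                      (∑-cong (upTo m) (λ i → ∑-map (i ∷_) (words m k)))

  ∑-words-cong : ∀ m k {f g} → (∀ w → length w ≡ k → All (_< m) w → f w ≈ g w) →
                 ∑ (words m k) f ≈ ∑ (words m k) g
  ∑-words-cong m zero    f≈g = +-congʳ (f≈g [] ≡.refl [])
  ∑-words-cong m (suc k) {f} {g} f≈g = begin
    ∑ (words m (suc k)) f                    ≈⟨ ∑-words m k ⟩
    ∑< m (λ i → ∑ (words m k) (f ∘ (i ∷_)))  ≈⟨ ∑<-cong m (λ i i<m → ∑-words-cong m k λ w |w| w< →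
                                                  f≈g (i ∷ w) (≡.cong suc |w|) (i<m ∷ w<)) ⟩
    ∑< m (λ i → ∑ (words m k) (g ∘ (i ∷_)))  ≈⟨ ∑-words m k ⟨
    ∑ (words m (suc k)) g                    ∎

  ∑-words-++ : ∀ m j k {f} → ∑ (words m (j ℕ.+ k)) f ≈
               ∑ (words m j) (λ u → ∑ (words m k) (λ v → f (u ++ v)))
  ∑-words-++ m zero    k = sym (+-identityʳ _)
  ∑-words-++ m (suc j) k {f} = begin
    ∑ (words m (suc j ℕ.+ k)) f
      ≈⟨ ∑-words m (j ℕ.+ k) ⟩
    ∑< m (λ i → ∑ (words m (j ℕ.+ k)) (f ∘ (i ∷_)))
      ≈⟨ ∑-cong (upTo m) (λ i → ∑-words-++ m j k) ⟩
    ∑< m (λ i → ∑ (words m j) (λ u → ∑ (words m k) (λ v → f (i ∷ u ++ v))))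
      ≈⟨ ∑-words m j ⟨
    ∑ (words m (suc j)) (λ u → ∑ (words m k) (λ v → f (u ++ v))) ∎

-- Paths and spiders

≡ᵇ-refl : ∀ n → (n ≡ᵇ n) ≡ true
≡ᵇ-refl zero    = ≡.refl
≡ᵇ-refl (suc n) = ≡ᵇ-refl n

<⇒≢ᵇ : ∀ {m n} → m < n → (m ≡ᵇ n) ≡ false
<⇒≢ᵇ {zero}  {suc n} _   = ≡.refl
<⇒≢ᵇ {suc m} {suc n} m<n = <⇒≢ᵇ (s<s⁻¹ m<n)

chain : ℕ → List ℕ → Bool
chain c []      = true
chain c (d ∷ w) = not (c ≡ᵇ d) ∧ chain d w

-- Sequences as power series in q

module Sequences {c ℓ} (R : CommutativeSemiring c ℓ) where
  open CommutativeSemiring R hiding (zero)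
  open ListSum R
  open import Relation.Binary.Reasoning.Setoid setoid
  open import Algebra.Properties.CommutativeSemigroup +-commutativeSemigroup
    using (interchange)

  -- Multiplication by q when a sequence is read as a power series; it stands for the index k - 1
  -- with value 0 at k = 0.
  sh : (ℕ → Carrier) → ℕ → Carrier
  sh f zero    = 0#
  sh f (suc k) = f k

  sh-cong : ∀ {f g} → (∀ k → f k ≈ g k) → ∀ k → sh f k ≈ sh g k
  sh-cong f≈g zero    = refl
  sh-cong f≈g (suc k) = f≈g k

  sh-+ : ∀ {f g} k → sh (λ i → f i + g i) k ≈ sh f k + sh g k
  sh-+ zero    = sym (+-identityˡ 0#)
  sh-+ (suc k) = refl

  sh-* : ∀ {f} r k → sh (λ i → r * f i) k ≈ r * sh f k
  sh-* r zero    = sym (zeroʳ r)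
  sh-* r (suc k) = refl

  -- The Cauchy product, by recursion through the first factor so that no truncated difference n - k
  -- occurs.
  conv : (ℕ → Carrier) → (ℕ → Carrier) → ℕ → Carrier
  conv f g zero    = f 0 * g 0
  conv f g (suc n) = f 0 * g (suc n) + conv (f ∘ suc) g n

  conv-cong : ∀ {f f′ g g′} → (∀ k → f k ≈ f′ k) → (∀ k → g k ≈ g′ k) →
              ∀ n → conv f g n ≈ conv f′ g′ n
  conv-cong f≈ g≈ zero    = *-cong (f≈ 0) (g≈ 0)
  conv-cong f≈ g≈ (suc n) = +-cong (*-cong (f≈ 0) (g≈ (suc n))) (conv-cong (f≈ ∘ suc) g≈ n)

  conv-congˡ : ∀ {f g g′} → (∀ k → g k ≈ g′ k) → ∀ n → conv f g n ≈ conv f g′ n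
  conv-congˡ g≈ = conv-cong (λ _ → refl) g≈

  conv-congʳ : ∀ {f f′ g} → (∀ k → f k ≈ f′ k) → ∀ n → conv f g n ≈ conv f′ g n
  conv-congʳ f≈ = conv-cong f≈ (λ _ → refl)

  conv-+ˡ : ∀ {f f′ g} n → conv (λ k → f k + f′ k) g n ≈ conv f g n + conv f′ g n
  conv-+ˡ zero    = distribʳ _ _ _
  conv-+ˡ (suc n) = trans (+-cong (distribʳ _ _ _) (conv-+ˡ n)) (interchange _ _ _ _)

  conv-+ʳ : ∀ {f g g′} n → conv f (λ k → g k + g′ k) n ≈ conv f g n + conv f g′ n
  conv-+ʳ zero    = distribˡ _ _ _
  conv-+ʳ (suc n) = trans (+-cong (distribˡ _ _ _) (conv-+ʳ n)) (interchange _ _ _ _)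

  conv-assocʳ : ∀ {f g} r n → conv (λ k → r * f k) g n ≈ conv f (λ k → r * g k) n
  conv-assocʳ {f} {g} r n = go f n
    where
    swap : ∀ a b → r * a * b ≈ a * (r * b)
    swap a b = trans (*-congʳ (*-comm r a)) (*-assoc a r b)
    go : ∀ f n → conv (λ k → r * f k) g n ≈ conv f (λ k → r * g k) n
    go f zero    = swap _ _
    go f (suc n) = +-cong (swap _ _) (go (f ∘ suc) n)

  conv-*ʳ : ∀ {f g} r n → conv f (λ k → r * g k) n ≈ r * conv f g n
  conv-*ʳ {f} {g} r n = go f n
    where
    swap : ∀ a b → a * (r * b) ≈ r * (a * b)
    swap a b = trans (sym (*-assoc a r b)) (trans (*-congʳ (*-comm a r)) (*-assoc r a b))
    go : ∀ f n → conv f (λ k → r * g k) n ≈ r * conv f g n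
    go f zero    = swap _ _
    go f (suc n) = trans (+-cong (swap _ _) (go (f ∘ suc) n)) (sym (distribˡ _ _ _))

  conv-last : ∀ {f g} n → conv f g (suc n) ≈ conv f (g ∘ suc) n + f (suc n) * g 0
  conv-last zero    = refl
  conv-last (suc n) = trans (+-congˡ (conv-last n)) (sym (+-assoc _ _ _))

  conv-sh : ∀ {f g} n → conv f (sh g) n ≈ conv (sh f) g n
  conv-sh zero = trans (zeroʳ _) (sym (zeroˡ _))
  conv-sh {f} {g} (suc n) = begin
    conv f (sh g) (suc n)            ≈⟨ conv-last n ⟩
    conv f g n + f (suc n) * 0#      ≈⟨ +-congˡ (zeroʳ _) ⟩
    conv f g n + 0#                  ≈⟨ +-comm _ _ ⟩
    0# + conv f g n                  ≈⟨ +-congʳ (zeroˡ _) ⟨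
    conv (sh f) g (suc n)            ∎

  conv-∑ˡ : ∀ {A : Set} (as : List A) {f : A → ℕ → Carrier} {g} n →
            conv (λ k → ∑ as (λ a → f a k)) g n ≈ ∑ as (λ a → conv (f a) g n)
  conv-∑ˡ as zero    = ∑-* as _
  conv-∑ˡ as (suc n) = trans (+-cong (∑-* as _) (conv-∑ˡ as n)) (sym (∑-+ as))

  conv-∑ʳ : ∀ {A : Set} (as : List A) {f} {g : A → ℕ → Carrier} n →
            conv f (λ k → ∑ as (λ a → g a k)) n ≈ ∑ as (λ a → conv f (g a) n)
  conv-∑ʳ as zero    = *-∑ _ as
  conv-∑ʳ as (suc n) = trans (+-cong (*-∑ _ as) (conv-∑ʳ as n)) (sym (∑-+ as))

  ×-0 : ∀ n → n × 0# ≈ 0#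
  ×-0 zero    = refl
  ×-0 (suc n) = trans (+-identityˡ _) (×-0 n)

  ×-+ : ∀ n a b → n × (a + b) ≈ n × a + n × b
  ×-+ zero    a b = sym (+-identityˡ 0#)
  ×-+ (suc n) a b = trans (+-congˡ (×-+ n a b)) (interchange _ _ _ _)

module PathPolynomials {c ℓ} (R : CommutativeSemiring c ℓ)
  (+-cancelˡ : LeftCancellative (CommutativeSemiring._≈_ R) (CommutativeSemiring._+_ R))
  (x : ℕ → CommutativeSemiring.Carrier R) where
  open CommutativeSemiring R hiding (zero)
  open ListSum R
  open Sequences R
  open import Relation.Binary.Reasoning.Setoid setoid
  open import Algebra.Solver.Ring.NaturalCoefficients.Default R
    using (solve; con; _:+_; _:*_; _:=_; Polynomial)
  open import Algebra.Properties.CommutativeSemigroup +-commutativeSemigroup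
    using (interchange)
  open import Algebra.Properties.CommutativeSemigroup *-commutativeSemigroup
    using () renaming (x∙yz≈y∙xz to x*yz≈y*xz)

  mono : List ℕ → Carrier
  mono = foldr (λ i → x i *_) 1#

  mono-++ : ∀ u v → mono (u ++ v) ≈ mono u * mono v
  mono-++ []      v = sym (*-identityˡ _)
  mono-++ (i ∷ u) v = trans (*-congˡ (mono-++ u v)) (sym (*-assoc _ _ _))

  -- Elementary symmetric polynomials

  e : ℕ → ℕ → Carrier
  e zero    zero    = 1#
  e zero    (suc k) = 0#
  e (suc m) k       = e m k + x m * sh (e m) k

  e₀ : ∀ m → e m 0 ≈ 1#
  e₀ zero    = refl
  e₀ (suc m) = trans (+-cong (e₀ m) (zeroʳ _)) (+-identityʳ _)

  -- ê c m k is eₖ in those of x₀ , … , xₘ₋₁ that differ from x c; only meaningful for c < m.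
  ê : ℕ → ℕ → ℕ → Carrier
  ê c zero    k = 0#
  ê c (suc m) k = if c ≡ᵇ m then e m k else ê c m k + x m * sh (ê c m) k

  ê-here : ∀ m k → ê m (suc m) k ≈ e m k
  ê-here m k rewrite ≡ᵇ-refl m = refl

  ê-there : ∀ {c m} k → c < m → ê c (suc m) k ≈ ê c m k + x m * sh (ê c m) k
  ê-there k c<m rewrite <⇒≢ᵇ c<m = refl

  -- In generating functions E = (1 + x_c q) Ê_c. For the last variable this is the recursion of
  -- `e`; otherwise the factors of the two variables commute.
  e-delete : ∀ {c} m → c < m → ∀ k → e m k ≈ ê c m k + x c * sh (ê c m) k
  e-delete {c} (suc m) c<1+m k with m<1+n⇒m<n∨m≡n c<1+m
  ... | inj₂ ≡.refl = sym (+-cong (ê-here m k) (*-congˡ (sh-cong (ê-here m) k)))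
  ... | inj₁ c<m = begin
    e m k + x m * sh (e m) k
      ≈⟨ +-cong (e-delete m c<m k) (*-congˡ (begin
           sh (e m) k                                     ≈⟨ sh-cong (e-delete m c<m) k ⟩
           sh (λ k → ê c m k + x c * sh (ê c m) k) k      ≈⟨ sh-+ k ⟩
           sh (ê c m) k + sh (λ k → x c * sh (ê c m) k) k ≈⟨ +-congˡ (sh-* (x c) k) ⟩
           sh (ê c m) k + x c * sh (sh (ê c m)) k         ∎)) ⟩
    (ê c m k + x c * sh (ê c m) k) + x m * (sh (ê c m) k + x c * sh (sh (ê c m)) k)
      ≈⟨ +-congˡ (distribˡ _ _ _) ⟩
    (ê c m k + x c * sh (ê c m) k) + (x m * sh (ê c m) k + x m * (x c * sh (sh (ê c m)) k))
      ≈⟨ interchange _ _ _ _ ⟩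
    (ê c m k + x m * sh (ê c m) k) + (x c * sh (ê c m) k + x m * (x c * sh (sh (ê c m)) k))
      ≈⟨ +-congˡ (+-congˡ (x*yz≈y*xz _ _ _)) ⟩
    (ê c m k + x m * sh (ê c m) k) + (x c * sh (ê c m) k + x c * (x m * sh (sh (ê c m)) k))
      ≈⟨ +-congˡ (distribˡ _ _ _) ⟨
    (ê c m k + x m * sh (ê c m) k) + x c * (sh (ê c m) k + x m * sh (sh (ê c m)) k)
      ≈⟨ +-cong (ê-there k c<m) (*-congˡ (begin
           sh (ê c (suc m)) k                             ≈⟨ sh-cong (λ k → ê-there k c<m) k ⟩
           sh (λ k → ê c m k + x m * sh (ê c m) k) k      ≈⟨ sh-+ k ⟩
           sh (ê c m) k + sh (λ k → x m * sh (ê c m) k) k ≈⟨ +-congˡ (sh-* (x m) k) ⟩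
           sh (ê c m) k + x m * sh (sh (ê c m)) k         ∎)) ⟨
    ê c (suc m) k + x c * sh (ê c (suc m)) k ∎

  -- A square-free monomial of degree k + 1 arises once from each of its k + 1 variables; as power
  -- series, ∑ x_c Ê_c = E′.
  ∑ê : ∀ m k → ∑< m (λ c → x c * ê c m k) ≈ suc k × e m (suc k)
  ∑ê zero    k = sym (×-0 (suc k))
  ∑ê (suc m) k = begin
    ∑< (suc m) (λ c → x c * ê c (suc m) k)
      ≈⟨ ∑<-last m ⟩
    ∑< m (λ c → x c * ê c (suc m) k) + x m * ê m (suc m) k
      ≈⟨ +-cong (∑<-cong m (λ c c<m → trans (*-congˡ (ê-there k c<m))
                  (trans (distribˡ _ _ _) (+-congˡ (x*yz≈y*xz _ _ _)))))
                (*-congˡ (ê-here m k)) ⟩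
    ∑< m (λ c → x c * ê c m k + x m * (x c * sh (ê c m) k)) + x m * e m k
      ≈⟨ +-congʳ (trans (∑-+ (upTo m)) (+-cong (∑ê m k) (sym (*-∑ (x m) (upTo m))))) ⟩
    (suc k × e m (suc k) + x m * ∑< m (λ c → x c * sh (ê c m) k)) + x m * e m k
      ≈⟨ +-congʳ (+-congˡ (*-congˡ (shifted k))) ⟩
    (suc k × e m (suc k) + x m * (k × e m k)) + x m * e m k
      ≈⟨ +-assoc _ _ _ ⟩
    suc k × e m (suc k) + (x m * (k × e m k) + x m * e m k)
      ≈⟨ +-congˡ (+-comm _ _) ⟩
    suc k × e m (suc k) + (x m * e m k + x m * (k × e m k))
      ≈⟨ +-congˡ (+-congˡ (×-comm-* k _ _)) ⟩
    suc k × e m (suc k) + suc k × (x m * e m k)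
      ≈⟨ ×-+ (suc k) _ _ ⟨
    suc k × e (suc m) (suc k) ∎
    where
    shifted : ∀ k → ∑< m (λ c → x c * sh (ê c m) k) ≈ k × e m k
    shifted zero    = trans (∑-cong (upTo m) (λ c → zeroʳ _)) (∑-0 (upTo m))
    shifted (suc k) = ∑ê m k

  ∑<-delete : ∀ m {c} → c < m → ∀ {g} → ∑< m g ≈ ∑< m (λ d → when (not (c ≡ᵇ d)) (g d)) + g c
  ∑<-delete (suc m) {zero} _ {g} = begin
    ∑< (suc m) g                  ≈⟨ ∑<-first m ⟩
    g 0 + ∑< m (g ∘ suc)          ≈⟨ +-comm _ _ ⟩
    ∑< m (g ∘ suc) + g 0          ≈⟨ +-congʳ (+-identityˡ _) ⟨
    (0# + ∑< m (g ∘ suc)) + g 0   ≈⟨ +-congʳ (∑<-first m) ⟨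
    ∑< (suc m) (λ d → when (not (0 ≡ᵇ d)) (g d)) + g 0 ∎
  ∑<-delete (suc m) {suc c} c<m {g} = begin
    ∑< (suc m) g                  ≈⟨ ∑<-first m ⟩
    g 0 + ∑< m (g ∘ suc)          ≈⟨ +-congˡ (∑<-delete m (s<s⁻¹ c<m)) ⟩
    g 0 + (∑< m (λ d → when (not (c ≡ᵇ d)) (g (suc d))) + g (suc c)) ≈⟨ +-assoc _ _ _ ⟨
    (g 0 + ∑< m (λ d → when (not (c ≡ᵇ d)) (g (suc d)))) + g (suc c) ≈⟨ +-congʳ (∑<-first m) ⟨
    ∑< (suc m) (λ d → when (not (suc c ≡ᵇ d)) (g d)) + g (suc c) ∎

  -- Path and spider polynomials in m variables

  module _ (m : ℕ) where

    -- The sum over the colourings of a leg of n vertices attached to a centre of colour c.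
    leg : ℕ → ℕ → Carrier
    leg c zero    = 1#
    leg c (suc n) = ∑< m (λ d → when (not (c ≡ᵇ d)) (x d * leg d n))

    path : ℕ → Carrier
    path zero    = 1#
    path (suc n) = ∑< m (λ c → x c * leg c n)

    leg-words : ∀ c n → ∑ (words m n) (λ w → when (chain c w) (mono w)) ≈ leg c n
    leg-words c zero    = +-identityʳ _
    leg-words c (suc n) = trans (∑-words m n) (∑-cong (upTo m) λ d → begin
      ∑ (words m n) (λ w → when (not (c ≡ᵇ d) ∧ chain d w) (x d * mono w))
        ≈⟨ ∑-cong (words m n) (λ w → trans (when-∧ (not (c ≡ᵇ d)) (chain d w))
             (when-cong (not (c ≡ᵇ d)) λ _ → sym (*-when (chain d w)))) ⟩
      ∑ (words m n) (λ w → when (not (c ≡ᵇ d)) (x d * when (chain d w) (mono w)))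
        ≈⟨ when-∑ (not (c ≡ᵇ d)) (words m n) ⟨
      when (not (c ≡ᵇ d)) (∑ (words m n) (λ w → x d * when (chain d w) (mono w)))
        ≈⟨ when-cong (not (c ≡ᵇ d)) (λ _ → trans (sym (*-∑ (x d) (words m n)))
             (*-congˡ (leg-words d n))) ⟩
      when (not (c ≡ᵇ d)) (x d * leg d n) ∎)

    -- The first vertex either avoids the colour c, or has it and becomes the centre for the rest.
    -- As power series, P = (1 + x_c q) L_c.
    path-leg : ∀ {c} → c < m → ∀ n → path n ≈ leg c n + sh (λ k → x c * leg c k) n
    path-leg c<m zero    = sym (+-identityʳ _)
    path-leg c<m (suc n) = ∑<-delete m c<m

    -- The factor 1 + x_c q changes sides: Ê_c P = Ê_c (1 + x_c q) L_c = E L_c.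
    conv-ê-path : ∀ {c} → c < m → ∀ n →
                  conv (λ k → x c * ê c m k) path n ≈ conv (e m) (λ k → x c * leg c k) n
    conv-ê-path {c} c<m n = begin
      conv xê path n                                       ≈⟨ conv-congˡ (path-leg c<m) n ⟩
      conv xê (λ k → leg c k + sh xleg k) n                ≈⟨ conv-+ʳ n ⟩
      conv xê (leg c) n + conv xê (sh xleg) n              ≈⟨ +-cong (conv-assocʳ (x c) n) (conv-sh n) ⟩
      conv (ê c m) xleg n + conv (sh xê) xleg n            ≈⟨ +-congˡ (conv-congʳ (sh-* (x c)) n) ⟩
      conv (ê c m) xleg n + conv (λ k → x c * sh (ê c m) k) xleg n ≈⟨ conv-+ˡ n ⟨
      conv (λ k → ê c m k + x c * sh (ê c m) k) xleg n     ≈⟨ conv-congʳ (e-delete m c<m) n ⟨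
      conv (e m) xleg n                                    ∎
      where
      xê xleg : ℕ → Carrier
      xê k   = x c * ê c m k
      xleg k = x c * leg c k

    -- The coefficient of qʲ⁺¹ in qE′ - E, from the classical formula P = E / (E - qE′).
    D : ℕ → Carrier
    D j = j × e m (suc j)

    -- ∑ₖ (k+1) eₖ₊₁ Pₙ₋ₖ = ∑ₖ eₖ Pₙ₊₁₋ₖ (k ≤ n), summing conv-ê-path over all colours c.
    path-rec : ∀ n → path (suc n) ≈ e m (suc n) + conv D path n
    path-rec n = +-cancelˡ (conv (e m ∘ suc) path n) _ _ (begin
      conv (e m ∘ suc) path n + path (suc n)
        ≈⟨ +-comm _ _ ⟩
      path (suc n) + conv (e m ∘ suc) path n
        ≈⟨ +-congʳ (trans (*-congʳ (e₀ m)) (*-identityˡ _)) ⟨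
      conv (e m) path (suc n)
        ≈⟨ conv-last n ⟩
      conv (e m) (path ∘ suc) n + e m (suc n) * 1#
        ≈⟨ +-cong (conv-∑ʳ (upTo m) n) (*-identityʳ _) ⟩
      ∑< m (λ c → conv (e m) (λ k → x c * leg c k) n) + e m (suc n)
        ≈⟨ +-congʳ (∑<-cong m (λ c c<m → conv-ê-path c<m n)) ⟨
      ∑< m (λ c → conv (λ k → x c * ê c m k) path n) + e m (suc n)
        ≈⟨ +-congʳ (conv-∑ˡ (upTo m) n) ⟨
      conv (λ k → ∑< m (λ c → x c * ê c m k)) path n + e m (suc n)
        ≈⟨ +-congʳ (conv-congʳ (∑ê m) n) ⟩
      conv (λ k → e m (suc k) + D k) path n + e m (suc n)
        ≈⟨ trans (+-congʳ (conv-+ˡ n)) (+-assoc _ _ _) ⟩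
      conv (e m ∘ suc) path n + (conv D path n + e m (suc n))
        ≈⟨ +-congˡ (+-comm _ _) ⟩
      conv (e m ∘ suc) path n + (e m (suc n) + conv D path n) ∎)

    path₁ : path 1 ≈ e m 1
    path₁ = trans (path-rec 0) (trans (+-congˡ (zeroˡ _)) (+-identityʳ _))

    spider₁ : ℕ → ℕ → Carrier
    spider₁ a b = ∑< m (λ c → x c * (leg c a * (leg c b * leg c 1)))

    -- `joined` colours the path formed by two legs at a centre. `doubled` colours two disjoint
    -- paths on a + 1 and b + 1 vertices whose end vertices share the colour c.
    joined doubled : ℕ → ℕ → Carrier
    joined  a b = ∑< m (λ c → x c * (leg c a * leg c b))
    doubled a b = ∑< m (λ c → x c * (x c * (leg c a * leg c b)))

    -- Two chosen end vertices of the disjoint paths have different colours, as if joined by an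
    -- edge, or equal ones: deletion and contraction without a subtraction.
    path*path : ∀ a b → path (suc a) * path (suc b) ≈ joined a (suc b) + doubled a b
    path*path a b = begin
      path (suc a) * path (suc b)
        ≈⟨ ∑-* (upTo m) _ ⟩
      ∑< m (λ c → x c * leg c a * path (suc b))
        ≈⟨ ∑<-cong m (λ c c<m → trans (*-congˡ (path-leg c<m (suc b)))
             (solve 4 (λ x a b′ b → x :* a :* (b′ :+ x :* b) := x :* (a :* b′) :+ x :* (x :* (a :* b)))
                    refl (x c) (leg c a) (leg c (suc b)) (leg c b))) ⟩
      ∑< m (λ c → x c * (leg c a * leg c (suc b)) + x c * (x c * (leg c a * leg c b)))
        ≈⟨ ∑-+ (upTo m) ⟩
      joined a (suc b) + doubled a b ∎

    -- The centre may slide along the path: the product of the two path polynomials and `doubled`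
    -- are both symmetric under exchanging a and b, so the remaining part of `path*path` is too.
    joined-shift : ∀ a b → joined (suc a) b ≈ joined a (suc b)
    joined-shift a b = +-cancelˡ (doubled a b) _ _ (begin
      doubled a b + joined (suc a) b
        ≈⟨ +-comm _ _ ⟩
      joined (suc a) b + doubled a b
        ≈⟨ +-cong (∑-cong (upTo m) (λ c → *-congˡ (*-comm _ _)))
                  (∑-cong (upTo m) (λ c → *-congˡ (*-congˡ (*-comm _ _)))) ⟩
      joined b (suc a) + doubled b a
        ≈⟨ path*path b a ⟨
      path (suc b) * path (suc a)
        ≈⟨ *-comm _ _ ⟩
      path (suc a) * path (suc b)
        ≈⟨ path*path a b ⟩
      joined a (suc b) + doubled a b
        ≈⟨ +-comm _ _ ⟩
      doubled a b + joined a (suc b) ∎)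

    joined≈path : ∀ a b → joined a b ≈ path (suc (a ℕ.+ b))
    joined≈path zero    b = ∑-cong (upTo m) (λ c → *-congˡ (*-identityˡ _))
    joined≈path (suc a) b = begin
      joined (suc a) b            ≈⟨ joined-shift a b ⟩
      joined a (suc b)            ≈⟨ joined≈path a (suc b) ⟩
      path (suc (a ℕ.+ suc b))    ≡⟨ ≡.cong (path ∘ suc) (ℕₚ.+-suc a b) ⟩
      path (suc (suc a ℕ.+ b))    ∎

    -- A free extra vertex, counted by e₁, either differs in colour from the centre, like the leaf
    -- of the spider, or agrees with it and squares x_c.
    spider₁+doubled : ∀ a b → spider₁ a b + doubled a b ≈ e m 1 * path (suc (a ℕ.+ b))
    spider₁+doubled a b = begin
      spider₁ a b + doubled a b
        ≈⟨ ∑-+ (upTo m) ⟨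
      ∑< m (λ c → x c * (leg c a * (leg c b * leg c 1)) + x c * (x c * (leg c a * leg c b)))
        ≈⟨ ∑-cong (upTo m) (λ c → solve 4 (λ x a b l →
             x :* (a :* (b :* l)) :+ x :* (x :* (a :* b)) := (l :+ x) :* (x :* (a :* b)))
             refl (x c) (leg c a) (leg c b) (leg c 1)) ⟩
      ∑< m (λ c → (leg c 1 + x c) * (x c * (leg c a * leg c b)))
        ≈⟨ ∑<-cong m (λ c c<m → *-congʳ (trans (+-congˡ (sym (*-identityʳ _)))
             (trans (sym (path-leg c<m 1)) path₁))) ⟩
      ∑< m (λ c → e m 1 * (x c * (leg c a * leg c b)))
        ≈⟨ *-∑ (e m 1) (upTo m) ⟨
      e m 1 * joined a b
        ≈⟨ *-congˡ (joined≈path a b) ⟩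
      e m 1 * path (suc (a ℕ.+ b)) ∎

    -- `doubled a b` is the surplus of the product of paths over one path, and exactly what the
    -- spider lacks to become e₁ times a path.
    spider₁-path : ∀ a b → spider₁ a b + path (suc b) * path (suc a) ≈
                   path (suc (suc (b ℕ.+ a))) + e m 1 * path (suc (b ℕ.+ a))
    spider₁-path a b = begin
      spider₁ a b + path (suc b) * path (suc a)
        ≈⟨ +-congˡ (trans (*-comm _ _) (path*path a b)) ⟩
      spider₁ a b + (joined a (suc b) + doubled a b)
        ≈⟨ solve 3 (λ s j d → s :+ (j :+ d) := j :+ (s :+ d)) refl _ _ _ ⟩
      joined a (suc b) + (spider₁ a b + doubled a b)
        ≈⟨ +-cong (joined≈path a (suc b)) (spider₁+doubled a b) ⟩
      path (suc (a ℕ.+ suc b)) + e m 1 * path (suc (a ℕ.+ b))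
        ≡⟨ ≡.cong₂ (λ i j → path (suc i) + e m 1 * path (suc j))
             (≡.trans (ℕₚ.+-suc a b) (≡.cong suc (ℕₚ.+-comm a b))) (ℕₚ.+-comm a b) ⟩
      path (suc (suc (b ℕ.+ a))) + e m 1 * path (suc (b ℕ.+ a)) ∎

    -- The j summands of `conv D g (j + a)` that contain g 0, ..., g (j - 1). Splitting them off
    -- leaves convolutions of the same length a for paths of different sizes.
    tail : ℕ → (ℕ → Carrier) → ℕ → Carrier
    tail zero    g a = 0#
    tail (suc j) g a = D (suc j ℕ.+ a) * g 0 + tail j (g ∘ suc) a

    conv-tail : ∀ j g a → conv D g (j ℕ.+ a) ≈ conv D (λ i → g (j ℕ.+ i)) a + tail j g a
    conv-tail zero    g a = sym (+-identityʳ _)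
    conv-tail (suc j) g a = begin
      conv D g (suc j ℕ.+ a)
        ≈⟨ conv-last (j ℕ.+ a) ⟩
      conv D (g ∘ suc) (j ℕ.+ a) + D (suc j ℕ.+ a) * g 0
        ≈⟨ +-congʳ (conv-tail j (g ∘ suc) a) ⟩
      (conv D (λ i → g (suc j ℕ.+ i)) a + tail j (g ∘ suc) a) + D (suc j ℕ.+ a) * g 0
        ≈⟨ trans (+-assoc _ _ _) (+-congˡ (+-comm _ _)) ⟩
      conv D (λ i → g (suc j ℕ.+ i)) a + tail (suc j) g a ∎

    -- `Y` shifts `X` by one and is extended to index 0 so that `Y-path` persists there: P₅ + e₁ P₄
    -- - P₅ P₀ = e₁ P₄.
    X Y : ℕ → Carrier
    X a = spider₁ a 4
    Y zero    = e m 1 * path 4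
    Y (suc a) = X a

    Y-path : ∀ i → Y i + path 5 * path i ≈ path (5 ℕ.+ i) + e m 1 * path (4 ℕ.+ i)
    Y-path zero    = trans (+-congˡ (*-identityʳ _)) (+-comm _ _)
    Y-path (suc a) = spider₁-path a 4

    -- The path recursion is applied to all three paths of `spider₁-path`, and `Y-path` combines
    -- their convolutions termwise. Adding P₅ times `conv D path a` to both sides makes the
    -- recursion for Pₐ₊₁ applicable on the left, and the same term is cancelled at the end.
    X-rec : ∀ a → X a + path 5 * e m (suc a) ≈
            (e m (6 ℕ.+ a) + e m 1 * e m (5 ℕ.+ a)) +
            (conv D Y a + (tail 5 path a + e m 1 * tail 4 path a))
    X-rec a = +-cancelˡ (path 5 * conv D path a) _ _ (begin
      path 5 * conv D path a + (X a + path 5 * e m (suc a))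
        ≈⟨ solve 4 (λ p c x e → p :* c :+ (x :+ p :* e) := x :+ p :* (e :+ c)) refl _ _ _ _ ⟩
      X a + path 5 * (e m (suc a) + conv D path a)
        ≈⟨ +-congˡ (*-congˡ (path-rec a)) ⟨
      X a + path 5 * path (suc a)
        ≈⟨ spider₁-path a 4 ⟩
      path (6 ℕ.+ a) + e m 1 * path (5 ℕ.+ a)
        ≈⟨ +-cong (trans (path-rec (5 ℕ.+ a)) (+-congˡ (conv-tail 5 path a)))
                  (*-congˡ (trans (path-rec (4 ℕ.+ a)) (+-congˡ (conv-tail 4 path a)))) ⟩
      (e m (6 ℕ.+ a) + (conv D (path ∘ (5 ℕ.+_)) a + tail 5 path a)) +
      e m 1 * (e m (5 ℕ.+ a) + (conv D (path ∘ (4 ℕ.+_)) a + tail 4 path a))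
        ≈⟨ solve 7 (λ e₆ c₅ t₅ e₁ e₅ c₄ t₄ →
             (e₆ :+ (c₅ :+ t₅)) :+ e₁ :* (e₅ :+ (c₄ :+ t₄)) :=
             (e₆ :+ e₁ :* e₅) :+ ((c₅ :+ e₁ :* c₄) :+ (t₅ :+ e₁ :* t₄))) refl _ _ _ _ _ _ _ ⟩
      (e m (6 ℕ.+ a) + e m 1 * e m (5 ℕ.+ a)) +
      ((conv D (path ∘ (5 ℕ.+_)) a + e m 1 * conv D (path ∘ (4 ℕ.+_)) a) +
       (tail 5 path a + e m 1 * tail 4 path a))
        ≈⟨ +-congˡ (+-congʳ convY) ⟩
      (e m (6 ℕ.+ a) + e m 1 * e m (5 ℕ.+ a)) +
      ((conv D Y a + path 5 * conv D path a) + (tail 5 path a + e m 1 * tail 4 path a))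
        ≈⟨ solve 4 (λ f y p t → f :+ ((y :+ p) :+ t) := p :+ (f :+ (y :+ t))) refl _ _ _ _ ⟩
      path 5 * conv D path a +
      ((e m (6 ℕ.+ a) + e m 1 * e m (5 ℕ.+ a)) +
       (conv D Y a + (tail 5 path a + e m 1 * tail 4 path a))) ∎)
      where
      convY : conv D (path ∘ (5 ℕ.+_)) a + e m 1 * conv D (path ∘ (4 ℕ.+_)) a ≈
              conv D Y a + path 5 * conv D path a
      convY = begin
        conv D (path ∘ (5 ℕ.+_)) a + e m 1 * conv D (path ∘ (4 ℕ.+_)) a
          ≈⟨ +-congˡ (conv-*ʳ (e m 1) a) ⟨
        conv D (path ∘ (5 ℕ.+_)) a + conv D (λ i → e m 1 * path (4 ℕ.+ i)) a
          ≈⟨ conv-+ʳ a ⟨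
        conv D (λ i → path (5 ℕ.+ i) + e m 1 * path (4 ℕ.+ i)) a
          ≈⟨ conv-congˡ Y-path a ⟨
        conv D (λ i → Y i + path 5 * path i) a
          ≈⟨ conv-+ʳ a ⟩
        conv D Y a + conv D (λ i → path 5 * path i) a
          ≈⟨ +-congˡ (conv-*ʳ (path 5) a) ⟩
        conv D Y a + path 5 * conv D path a ∎

    -- Small paths and absorption of the negative term

    infixr 8 _:×_
    -- Unfolds in step with `_×_`, so that solver equations agree literally with the goals.
    _:×_ : ∀ {n} → ℕ → Polynomial n → Polynomial n
    zero  :× p = con 0
    suc n :× p = p :+ n :× p

    path-rec₂ : ∀ n → path (2 ℕ.+ n) ≈ e m (2 ℕ.+ n) + (conv D (path ∘ suc) n + D (suc n))
    path-rec₂ n = trans (path-rec (suc n)) (+-congˡ (trans (conv-last n) (+-congˡ (*-identityʳ _))))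

    path₂ : path 2 ≈ 2 × e m 2
    path₂ = trans (path-rec₂ 0) (solve 2 (λ p₁ e₂ →
      e₂ :+ (con 0 :* p₁ :+ 1 :× e₂) := 2 :× e₂) refl (path 1) (e m 2))

    path₃ : path 3 ≈ 3 × e m 3 + e m 2 * e m 1
    path₃ = begin
      path 3
        ≈⟨ path-rec₂ 1 ⟩
      e m 3 + ((0# * path 2 + D 1 * path 1) + D 2)
        ≈⟨ +-congˡ (+-congʳ (+-congˡ (*-congˡ path₁))) ⟩
      e m 3 + ((0# * path 2 + D 1 * e m 1) + D 2)
        ≈⟨ solve 4 (λ p₂ e₁ e₂ e₃ →
             e₃ :+ ((con 0 :* p₂ :+ (1 :× e₂) :* e₁) :+ 2 :× e₃) := 3 :× e₃ :+ e₂ :* e₁)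
             refl (path 2) (e m 1) (e m 2) (e m 3) ⟩
      3 × e m 3 + e m 2 * e m 1 ∎

    path₄ : path 4 ≈ 4 × e m 4 + (2 × (e m 2 * e m 2) + 2 × (e m 3 * e m 1))
    path₄ = begin
      path 4
        ≈⟨ path-rec₂ 2 ⟩
      e m 4 + ((0# * path 3 + (D 1 * path 2 + D 2 * path 1)) + D 3)
        ≈⟨ +-congˡ (+-congʳ (+-congˡ (+-cong (*-congˡ path₂) (*-congˡ path₁)))) ⟩
      e m 4 + ((0# * path 3 + (D 1 * (2 × e m 2) + D 2 * e m 1)) + D 3)
        ≈⟨ solve 5 (λ p₃ e₁ e₂ e₃ e₄ →
             e₄ :+ ((con 0 :* p₃ :+ ((1 :× e₂) :* (2 :× e₂) :+ (2 :× e₃) :* e₁)) :+ 3 :× e₄) :=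
             4 :× e₄ :+ (2 :× (e₂ :* e₂) :+ 2 :× (e₃ :* e₁)))
             refl (path 3) (e m 1) (e m 2) (e m 3) (e m 4) ⟩
      4 × e m 4 + (2 × (e m 2 * e m 2) + 2 × (e m 3 * e m 1)) ∎

    path₅ : path 5 ≈ 5 × e m 5 + (3 × (e m 4 * e m 1) + (7 × (e m 3 * e m 2) + e m 2 * e m 2 * e m 1))
    path₅ = begin
      path 5
        ≈⟨ path-rec₂ 3 ⟩
      e m 5 + ((0# * path 4 + (D 1 * path 3 + (D 2 * path 2 + D 3 * path 1))) + D 4)
        ≈⟨ +-congˡ (+-congʳ (+-congˡ (+-cong (*-congˡ path₃) (+-cong (*-congˡ path₂) (*-congˡ path₁))))) ⟩
      e m 5 + ((0# * path 4 + (D 1 * (3 × e m 3 + e m 2 * e m 1) +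
        (D 2 * (2 × e m 2) + D 3 * e m 1))) + D 4)
        ≈⟨ solve 6 (λ p₄ e₁ e₂ e₃ e₄ e₅ →
             e₅ :+ ((con 0 :* p₄ :+ ((1 :× e₂) :* (3 :× e₃ :+ e₂ :* e₁) :+
               ((2 :× e₃) :* (2 :× e₂) :+ (3 :× e₄) :* e₁))) :+ 4 :× e₅) :=
             5 :× e₅ :+ (3 :× (e₄ :* e₁) :+ (7 :× (e₃ :* e₂) :+ e₂ :* e₂ :* e₁)))
             refl (path 4) (e m 1) (e m 2) (e m 3) (e m 4) (e m 5) ⟩
      5 × e m 5 + (3 × (e m 4 * e m 1) + (7 × (e m 3 * e m 2) + e m 2 * e m 2 * e m 1)) ∎

    -- A leg of length 0 disappears, leaving one path; since P₁ = e₁, the two correction terms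
    -- coincide.
    X₀ : X 0 ≈ path 6
    X₀ = +-cancelˡ (path 5 * path 1) _ _ (begin
      path 5 * path 1 + X 0      ≈⟨ +-comm _ _ ⟩
      X 0 + path 5 * path 1      ≈⟨ spider₁-path 0 4 ⟩
      path 6 + e m 1 * path 5    ≈⟨ +-congˡ (trans (*-comm _ _) (*-congˡ (sym path₁))) ⟩
      path 6 + path 5 * path 1   ≈⟨ +-comm _ _ ⟩
      path 5 * path 1 + path 6   ∎)

    -- `t k` stands for the Schur polynomial of (2, 1ᵏ). Only this relation to the eₖ's is used
    -- here; it is later supplied by `e*e₁`.
    module _ {t : ℕ → Carrier} (pieri₁ : ∀ k → k < 4 → e m (suc k) * e m 1 ≈ e m (2 ℕ.+ k) + t k) where

      -- Of 8 e₄e₁ + 4 e₂e₂e₁ + 4 e₃e₁e₁, the part 3 e₄e₁ + e₂e₂e₁ already belongs to P₅.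
      -- Straightening the rest yields 5 e₅ and (3 + 4) e₃e₂, which completes P₅, plus the hooks.
      two-e₁P₄ : 2 × (e m 1 * path 4) ≈
                 path 5 + (5 × t 3 + (3 × (e m 2 * t 1) + 4 × (e m 3 * t 0)))
      two-e₁P₄ = begin
        2 × (e m 1 * path 4)
          ≈⟨ ×-congʳ 2 (*-congˡ path₄) ⟩
        2 × (e m 1 * (4 × e m 4 + (2 × (e m 2 * e m 2) + 2 × (e m 3 * e m 1))))
          ≈⟨ solve 4 (λ e₁ e₂ e₃ e₄ →
               2 :× (e₁ :* (4 :× e₄ :+ (2 :× (e₂ :* e₂) :+ 2 :× (e₃ :* e₁)))) :=
               (3 :× (e₄ :* e₁) :+ e₂ :* e₂ :* e₁) :+
               (5 :× (e₄ :* e₁) :+ (3 :× (e₂ :* (e₂ :* e₁)) :+ 4 :× (e₃ :* (e₁ :* e₁)))))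
               refl (e m 1) (e m 2) (e m 3) (e m 4) ⟩
        (3 × (e m 4 * e m 1) + e m 2 * e m 2 * e m 1) +
        (5 × (e m 4 * e m 1) + (3 × (e m 2 * (e m 2 * e m 1)) + 4 × (e m 3 * (e m 1 * e m 1))))
          ≈⟨ +-congˡ (+-cong (×-congʳ 5 (pieri₁ 3 (n<1+n 3))) (+-cong (×-congʳ 3 (*-congˡ (pieri₁ 1 (s<s z<s))))
               (×-congʳ 4 (*-congˡ (pieri₁ 0 z<s))))) ⟩
        (3 × (e m 4 * e m 1) + e m 2 * e m 2 * e m 1) +
        (5 × (e m 5 + t 3) + (3 × (e m 2 * (e m 3 + t 1)) + 4 × (e m 3 * (e m 2 + t 0))))
          ≈⟨ solve 8 (λ e₁ e₂ e₃ e₄ e₅ t₀ t₁ t₃ →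
               (3 :× (e₄ :* e₁) :+ e₂ :* e₂ :* e₁) :+
               (5 :× (e₅ :+ t₃) :+ (3 :× (e₂ :* (e₃ :+ t₁)) :+ 4 :× (e₃ :* (e₂ :+ t₀)))) :=
               (5 :× e₅ :+ (3 :× (e₄ :* e₁) :+ (7 :× (e₃ :* e₂) :+ e₂ :* e₂ :* e₁))) :+
               (5 :× t₃ :+ (3 :× (e₂ :* t₁) :+ 4 :× (e₃ :* t₀))))
               refl (e m 1) (e m 2) (e m 3) (e m 4) (e m 5) (t 0) (t 1) (t 3) ⟩
        (5 × e m 5 + (3 × (e m 4 * e m 1) + (7 × (e m 3 * e m 2) + e m 2 * e m 2 * e m 1))) +
        (5 × t 3 + (3 × (e m 2 * t 1) + 4 × (e m 3 * t 0)))
          ≈⟨ +-congʳ path₅ ⟨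
        path 5 + (5 × t 3 + (3 × (e m 2 * t 1) + 4 × (e m 3 * t 0))) ∎

      -- With a = 1 only one copy of e₂ e₁ P₄ is available, so P₅ e₂ is also paid for by the tail
      -- terms D₄ P₂, D₂ P₄ and e₁ D₂ P₃. These four products are expanded; the other terms,
      -- collected in `rest`, are nonnegative and left alone.
      X₁ : X 1 ≈ (e m 7 + e m 1 * e m 6) +
           ((D 6 * path 0 + (D 5 * path 1 + D 3 * path 3)) +
            (e m 1 * (D 5 * path 0 + (D 4 * path 1 + D 3 * path 2)) +
             (3 × (e m 5 * e m 2) + (e m 4 * (e m 2 * e m 1) + (e m 2 * (e m 2 * (e m 2 * e m 1)) +
              (e m 3 * (e m 2 * (e m 1 * e m 1)) + (3 × (e m 3 * (e m 2 * t 0)) +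
               (8 × (e m 4 * e m 3) + 10 × (e m 3 * (e m 3 * e m 1))))))))))
      X₁ = +-cancelˡ (path 5 * e m 2) _ _ (begin
        path 5 * e m 2 + X 1
          ≈⟨ trans (+-comm _ _) (X-rec 1) ⟩
        (e m 7 + e m 1 * e m 6) + ((0# * X 0 + D 1 * (e m 1 * path 4)) +
          ((D 6 * path 0 + (D 5 * path 1 + (D 4 * path 2 + (D 3 * path 3 + (D 2 * path 4 + 0#))))) +
           e m 1 * (D 5 * path 0 + (D 4 * path 1 + (D 3 * path 2 + (D 2 * path 3 + 0#))))))
          ≈⟨ solve 15 (λ f x₀ d₁ e₁ p₄ a₀ a₁ d₄ p₂ a₃ d₂ b₀ b₁ b₂ p₃ →
               f :+ ((con 0 :* x₀ :+ d₁ :* (e₁ :* p₄)) :+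
                ((a₀ :+ (a₁ :+ (d₄ :* p₂ :+ (a₃ :+ (d₂ :* p₄ :+ con 0))))) :+
                 e₁ :* (b₀ :+ (b₁ :+ (b₂ :+ (d₂ :* p₃ :+ con 0)))))) :=
               (f :+ ((a₀ :+ (a₁ :+ a₃)) :+ e₁ :* (b₀ :+ (b₁ :+ b₂)))) :+
               (d₁ :* (e₁ :* p₄) :+ (d₄ :* p₂ :+ (d₂ :* p₄ :+ e₁ :* (d₂ :* p₃)))))
               refl _ (X 0) (D 1) (e m 1) (path 4) _ _ (D 4) (path 2) _ (D 2) _ _ _ (path 3) ⟩
        rest + (D 1 * (e m 1 * path 4) + (D 4 * path 2 + (D 2 * path 4 + e m 1 * (D 2 * path 3))))
          ≈⟨ +-congˡ (+-cong (*-congˡ (*-congˡ path₄)) (+-cong (*-congˡ path₂)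
               (+-cong (*-congˡ path₄) (*-congˡ (*-congˡ path₃))))) ⟩
        rest + (D 1 * (e m 1 * (4 × e m 4 + (2 × (e m 2 * e m 2) + 2 × (e m 3 * e m 1)))) +
          (D 4 * (2 × e m 2) + (D 2 * (4 × e m 4 + (2 × (e m 2 * e m 2) + 2 × (e m 3 * e m 1))) +
            e m 1 * (D 2 * (3 × e m 3 + e m 2 * e m 1)))))
          ≈⟨ +-congˡ (solve 5 (λ e₁ e₂ e₃ e₄ e₅ →
               (1 :× e₂) :* (e₁ :* (4 :× e₄ :+ (2 :× (e₂ :* e₂) :+ 2 :× (e₃ :* e₁)))) :+
               ((4 :× e₅) :* (2 :× e₂) :+
                ((2 :× e₃) :* (4 :× e₄ :+ (2 :× (e₂ :* e₂) :+ 2 :× (e₃ :* e₁))) :+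
                 e₁ :* ((2 :× e₃) :* (3 :× e₃ :+ e₂ :* e₁)))) :=
               (5 :× e₅ :+ (3 :× (e₄ :* e₁) :+ (4 :× (e₃ :* e₂) :+ e₂ :* e₂ :* e₁))) :* e₂ :+
               (3 :× (e₃ :* (e₂ :* (e₁ :* e₁))) :+
                (3 :× (e₅ :* e₂) :+ (e₄ :* (e₂ :* e₁) :+ (e₂ :* (e₂ :* (e₂ :* e₁)) :+
                 (e₃ :* (e₂ :* (e₁ :* e₁)) :+
                  (8 :× (e₄ :* e₃) :+ 10 :× (e₃ :* (e₃ :* e₁)))))))))
               refl (e m 1) (e m 2) (e m 3) (e m 4) (e m 5)) ⟩
        rest + ((5 × e m 5 + (3 × (e m 4 * e m 1) + (4 × (e m 3 * e m 2) + e m 2 * e m 2 * e m 1))) * e m 2 +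
          (3 × (e m 3 * (e m 2 * (e m 1 * e m 1))) +
           (3 × (e m 5 * e m 2) + (e m 4 * (e m 2 * e m 1) + (e m 2 * (e m 2 * (e m 2 * e m 1)) +
            (e m 3 * (e m 2 * (e m 1 * e m 1)) +
             (8 × (e m 4 * e m 3) + 10 × (e m 3 * (e m 3 * e m 1)))))))))
          -- The expansion contains only 4 of the 7 copies of e₃e₂e₂ in P₅ e₂; straightening e₁e₁ in
          -- 3 copies of e₃e₂e₁e₁ supplies the other 3.
          ≈⟨ +-congˡ (+-congˡ (+-congʳ (×-congʳ 3 (*-congˡ (*-congˡ (pieri₁ 0 z<s)))))) ⟩
        rest + ((5 × e m 5 + (3 × (e m 4 * e m 1) + (4 × (e m 3 * e m 2) + e m 2 * e m 2 * e m 1))) * e m 2 +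
          (3 × (e m 3 * (e m 2 * (e m 2 + t 0))) +
           (3 × (e m 5 * e m 2) + (e m 4 * (e m 2 * e m 1) + (e m 2 * (e m 2 * (e m 2 * e m 1)) +
            (e m 3 * (e m 2 * (e m 1 * e m 1)) +
             (8 × (e m 4 * e m 3) + 10 × (e m 3 * (e m 3 * e m 1)))))))))
          ≈⟨ solve 15 (λ f a b e₁ e₂ e₃ t₀ e₅ e₄₁ g₁ g₂ g₃ g₄ g₅ g₆ →
               (f :+ (a :+ b)) :+
               ((5 :× e₅ :+ (3 :× e₄₁ :+ (4 :× (e₃ :* e₂) :+ e₂ :* e₂ :* e₁))) :* e₂ :+
                (3 :× (e₃ :* (e₂ :* (e₂ :+ t₀))) :+ (g₁ :+ (g₂ :+ (g₃ :+ (g₄ :+ (g₅ :+ g₆))))))) :=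
               (5 :× e₅ :+ (3 :× e₄₁ :+ (7 :× (e₃ :* e₂) :+ e₂ :* e₂ :* e₁))) :* e₂ :+
               (f :+ (a :+ (b :+ (g₁ :+ (g₂ :+ (g₃ :+ (g₄ :+ (3 :× (e₃ :* (e₂ :* t₀)) :+
                 (g₅ :+ g₆))))))))))
               refl _ _ _ (e m 1) (e m 2) (e m 3) (t 0) (e m 5) (e m 4 * e m 1) _ _ _ _ _ _ ⟩
        _ ≈⟨ +-congʳ (*-congʳ path₅) ⟨
        path 5 * e m 2 + _ ∎)
        where
        rest : Carrier
        rest = (e m 7 + e m 1 * e m 6) + ((D 6 * path 0 + (D 5 * path 1 + D 3 * path 3)) +
               e m 1 * (D 5 * path 0 + (D 4 * path 1 + D 3 * path 2)))

      -- The last summand of `conv D Y` is a + 2 copies of eₐ₊₃ e₁ P₄: two of them cover P₅ eₐ₊₃ by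
      -- `two-e₁P₄`, and a are left over.
      X₂₊ : ∀ a → X (2 ℕ.+ a) ≈ (e m (8 ℕ.+ a) + e m 1 * e m (7 ℕ.+ a)) +
            ((conv D X (suc a) + a × (e m (3 ℕ.+ a) * (e m 1 * path 4))) +
             (e m (3 ℕ.+ a) * (5 × t 3 + (3 × (e m 2 * t 1) + 4 × (e m 3 * t 0))) +
              (tail 5 path (2 ℕ.+ a) + e m 1 * tail 4 path (2 ℕ.+ a))))
      X₂₊ a = +-cancelˡ (path 5 * e₊) _ _ (begin
        path 5 * e₊ + X (2 ℕ.+ a)
          ≈⟨ trans (+-comm _ _) (X-rec (2 ℕ.+ a)) ⟩
        _ + (conv D Y (2 ℕ.+ a) + _)
          ≈⟨ +-congˡ (+-congʳ (begin
               conv D Y (2 ℕ.+ a)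
                 ≈⟨ conv-last {D} {Y} (suc a) ⟩
               conv D X (suc a) + (2 ℕ.+ a) × e₊ * q
                 ≈⟨ +-congˡ (solve 3 (λ e q n → (e :+ (e :+ n)) :* q :=
                      e :* (2 :× q) :+ n :* q) refl e₊ q (a × e₊)) ⟩
               conv D X (suc a) + (e₊ * (2 × q) + (a × e₊) * q)
                 ≈⟨ +-congˡ (+-cong (*-congˡ two-e₁P₄) (×-assoc-* a e₊ q)) ⟩
               conv D X (suc a) + (e₊ * (path 5 + r) + a × (e₊ * q))
                 ∎)) ⟩
        _ + ((conv D X (suc a) + (e₊ * (path 5 + r) + a × (e₊ * q))) + _)
          ≈⟨ solve 7 (λ f c e p r n t → f :+ ((c :+ (e :* (p :+ r) :+ n)) :+ t) :=
               p :* e :+ (f :+ ((c :+ n) :+ (e :* r :+ t)))) refl _ _ e₊ (path 5) r _ _ ⟩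
        path 5 * e₊ + _ ∎)
        where
        e₊ q r : Carrier
        e₊ = e m (3 ℕ.+ a)
        q  = e m 1 * path 4
        r  = 5 × t 3 + (3 × (e m 2 * t 1) + 4 × (e m 3 * t 0))

-- Horizontal and vertical strips

≤ᵇ-true : ∀ {m n} → m ≤ n → (m ≤ᵇ n) ≡ true
≤ᵇ-true {m} {n} m≤n with m ≤ᵇ n | ≤⇒≤ᵇ m≤n
... | true | _ = ≡.refl

≤ᵇ-sound : ∀ {m n} → (m ≤ᵇ n) ≡ true → m ≤ n
≤ᵇ-sound {m} {n} eq = ≤ᵇ⇒≤ m n (≡.subst T (≡.sym eq) tt)

≤ᵇ-false : ∀ {m n} → n < m → (m ≤ᵇ n) ≡ false
≤ᵇ-false {m} {n} n<m with m ≤ᵇ n in eq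
... | false = ≡.refl
... | true  = ⊥-elim (<⇒≱ n<m (≤ᵇ-sound eq))

≤ᵇ-suc : ∀ m n → (suc m ≤ᵇ suc n) ≡ (m ≤ᵇ n)
≤ᵇ-suc zero    n = ≡.refl
≤ᵇ-suc (suc m) n = ≡.refl

∧-true : ∀ a {b} → a ∧ b ≡ true → (a ≡ true) & (b ≡ true)
∧-true true eq = ≡.refl , eq

data Desc : ℕ → List ℕ → Set where
  []  : ∀ {b} → Desc b []
  _∷_ : ∀ {b r ρ} → r ≤ b → Desc r ρ → Desc b (r ∷ ρ)

-- The restricted `[]` forces the sequence b, ρ to end in 0. Without an empty last row the factor 1
-- + q of `exchange-<` would fail at the bottom, where no further row can be raised.
data Desc₀ : ℕ → List ℕ → Set where
  []  : Desc₀ 0 []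
  _∷_ : ∀ {b r ρ} → r ≤ b → Desc₀ r ρ → Desc₀ b (r ∷ ρ)

desc? : ∀ b ρ → Dec (Desc b ρ)
desc? b []      = yes []
desc? b (r ∷ ρ) with r ≤? b | desc? r ρ
... | yes r≤b | yes d = yes (r≤b ∷ d)
... | no  r≰b | _     = no λ { (r≤b ∷ _) → r≰b r≤b }
... | _       | no ¬d = no λ { (_ ∷ d) → ¬d d }

-- With fewer boxes than rows some row is empty, and then so are all rows below it.
desc⇒desc₀ : ∀ {b ρ} → Desc b ρ → sum ρ < length ρ → Desc₀ b ρ
desc⇒desc₀ {ρ = zero ∷ ρ}  (r≤b ∷ d) lt = r≤b ∷ zeros d
  where
  zeros : ∀ {ρ} → Desc 0 ρ → Desc₀ 0 ρ
  zeros []        = []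
  zeros (z≤n ∷ d) = z≤n ∷ zeros d
desc⇒desc₀ {ρ = suc r ∷ ρ} (r≤b ∷ d) lt =
  r≤b ∷ desc⇒desc₀ d (≤-trans (s≤s (ℕₚ.m≤n+m (sum ρ) r)) (s≤s⁻¹ lt))

head₀ : List ℕ → ℕ
head₀ []      = 0
head₀ (l ∷ _) = l

desc-head : ∀ {b ρ} → Desc b ρ → head₀ ρ ≤ b
desc-head []        = z≤n
desc-head (r≤b ∷ _) = r≤b

rebound : ∀ {b b′ ρ} → head₀ ρ ≤ b′ → Desc b ρ → Desc b′ ρ
rebound _    []      = []
rebound r≤b′ (_ ∷ d) = r≤b′ ∷ d

-- b ≥ λ₁ ≥ ρ₁ ≥ λ₂ ≥ ρ₂ ≥ …, that is, λ/ρ is a horizontal strip (and λ₁ ≤ b).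
interlace : ℕ → List ℕ → List ℕ → Bool
interlace b []      []      = true
interlace b (l ∷ λs) (r ∷ ρ) = (l ≤ᵇ b) ∧ ((r ≤ᵇ l) ∧ interlace r λs ρ)
interlace b _       _       = false

interlace-desc : ∀ b λs ρ → interlace b λs ρ ≡ true → Desc b λs
interlace-desc b []       []      _  = []
interlace-desc b (l ∷ λs) (r ∷ ρ) eq with ∧-true (l ≤ᵇ b) eq
... | l≤b , eq′ with ∧-true (r ≤ᵇ l) eq′
...   | r≤l , eq″ = ≤ᵇ-sound l≤b ∷ rebound (≤-trans (desc-head d) (≤ᵇ-sound r≤l)) d
  where
  d : Desc r λs
  d = interlace-desc r λs ρ eq″

interlace-descʳ : ∀ b λs ρ → interlace b λs ρ ≡ true → Desc b ρ
interlace-descʳ b []       []      _  = []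
interlace-descʳ b (l ∷ λs) (r ∷ ρ) eq with ∧-true (l ≤ᵇ b) eq
... | l≤b , eq′ with ∧-true (r ≤ᵇ l) eq′
...   | r≤l , eq″ = ≤-trans (≤ᵇ-sound r≤l) (≤ᵇ-sound {l} {b} l≤b) ∷ interlace-descʳ r λs ρ eq″

interlace-sum : ∀ b λs ρ → interlace b λs ρ ≡ true → sum ρ ≤ sum λs
interlace-sum b []       []      _  = z≤n
interlace-sum b (l ∷ λs) (r ∷ ρ) eq with ∧-true (l ≤ᵇ b) eq
... | l≤b , eq′ with ∧-true (r ≤ᵇ l) eq′
...   | r≤l , eq″ = ℕₚ.+-mono-≤ (≤ᵇ-sound r≤l) (interlace-sum r λs ρ eq″)

interlace-vanish : ∀ {b} λs μ → b < head₀ λs → interlace b λs μ ≡ false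
interlace-vanish (l ∷ λs) []      _   = ≡.refl
interlace-vanish (l ∷ λs) (r ∷ μ) b<l rewrite ≤ᵇ-false b<l = ≡.refl

interlace-bound : ∀ {b b′} λs μ → head₀ λs ≤ b → head₀ λs ≤ b′ → interlace b λs μ ≡ interlace b′ λs μ
interlace-bound []       []      _   _    = ≡.refl
interlace-bound []       (_ ∷ _) _   _    = ≡.refl
interlace-bound (l ∷ λs) []      _   _    = ≡.refl
interlace-bound (l ∷ λs) (r ∷ μ) l≤b l≤b′ rewrite ≤ᵇ-true l≤b | ≤ᵇ-true l≤b′ = ≡.refl

shᴸ : ∀ {A : Set} → (ℕ → List A) → ℕ → List A
shᴸ f zero    = []
shᴸ f (suc k) = f k

-- Adds a vertical strip: k distinct rows grow by one box. The results need not be weakly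
-- decreasing; `interlace` and `s-vanish` discard the others.
addStrip : List ℕ → ℕ → List (List ℕ)
addStrip []      zero    = [ [] ]
addStrip []      (suc k) = []
addStrip (l ∷ λs) k      = map (l ∷_) (addStrip λs k) ++ map (suc l ∷_) (shᴸ (addStrip λs) k)

delStrip : List ℕ → ℕ → List (List ℕ)
delStrip []          zero    = [ [] ]
delStrip []          (suc k) = []
delStrip (zero ∷ ρ)  k       = map (0 ∷_) (delStrip ρ k)
delStrip (suc r ∷ ρ) k       = map (suc r ∷_) (delStrip ρ k) ++ map (r ∷_) (shᴸ (delStrip ρ) k)

addStrip-zero : ∀ λs → addStrip λs 0 ≡ [ λs ]
addStrip-zero []       = ≡.refl
addStrip-zero (l ∷ λs) rewrite addStrip-zero λs = ≡.refl

addStrip-All : ∀ λs k → All (λ ν → (length ν ≡ length λs) & (sum ν ≡ sum λs ℕ.+ k)) (addStrip λs k)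
addStrip-All []       zero    = (≡.refl , ≡.refl) ∷ []
addStrip-All []       (suc k) = []
addStrip-All (l ∷ λs) k = ++⁺
  (map⁺ (All.map (λ { (p , q) → ≡.cong suc p , ≡.trans (≡.cong (l ℕ.+_) q) (≡.sym (ℕₚ.+-assoc l _ _)) })
    (addStrip-All λs k)))
  (map⁺ (shifted k))
  where
  shifted : ∀ k → All (λ ν → (suc (length ν) ≡ suc (length λs)) & (suc l ℕ.+ sum ν ≡ (l ℕ.+ sum λs) ℕ.+ k))
                      (shᴸ (addStrip λs) k)
  shifted zero    = []
  shifted (suc k) = All.map (λ { (p , q) → ≡.cong suc p ,
    ≡.trans (≡.cong (suc l ℕ.+_) q) (≡.trans (≡.cong suc (≡.sym (ℕₚ.+-assoc l _ _))) (≡.sym (ℕₚ.+-suc _ k))) })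
    (addStrip-All λs k)

delStrip-All : ∀ ρ k → All (λ μ → sum ρ ≡ sum μ ℕ.+ k) (delStrip ρ k)
delStrip-All []          zero    = ≡.refl ∷ []
delStrip-All []          (suc k) = []
delStrip-All (zero ∷ ρ)  k       = map⁺ (delStrip-All ρ k)
delStrip-All (suc r ∷ ρ) k       = ++⁺
  (map⁺ (All.map (λ q → ≡.trans (≡.cong (suc r ℕ.+_) q) (≡.sym (ℕₚ.+-assoc (suc r) _ _))) (delStrip-All ρ k)))
  (map⁺ (shifted k))
  where
  shifted : ∀ k → All (λ μ → suc r ℕ.+ sum ρ ≡ (r ℕ.+ sum μ) ℕ.+ k) (shᴸ (delStrip ρ) k)
  shifted zero    = []
  shifted (suc k) = All.map (λ q → ≡.trans (≡.cong (suc r ℕ.+_) q)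
    (≡.trans (≡.cong suc (≡.sym (ℕₚ.+-assoc r _ _))) (≡.sym (ℕₚ.+-suc _ k)))) (delStrip-All ρ k)

module StripExchange {c ℓ} (R : CommutativeSemiring c ℓ) where
  open CommutativeSemiring R hiding (zero)
  open ListSum R
  open Sequences R
  open import Relation.Binary.Reasoning.Setoid setoid
  open import Algebra.Properties.CommutativeSemigroup +-commutativeSemigroup
    using (interchange)

  -- Both pass from λ to ρ through an intermediate shape: `up` first adds a vertical strip and then
  -- removes a horizontal one, `down` does so in the opposite order. Each is the number of
  -- intermediate shapes times the constant z.
  up down : Carrier → ℕ → List ℕ → List ℕ → ℕ → Carrier
  up   z b λs ρ k = ∑ (addStrip λs k) (λ ν → when (interlace b ν ρ) z)
  down z b λs ρ k = ∑ (delStrip ρ k) (λ μ → when (interlace b λs μ) z)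

  ∑-shᴸ : ∀ {A : Set} (f : ℕ → List A) {g : A → Carrier} k →
          ∑ (shᴸ f k) g ≈ sh (λ k → ∑ (f k) g) k
  ∑-shᴸ f zero    = refl
  ∑-shᴸ f (suc k) = refl

  when-sh : ∀ b {f} k → sh (λ k → when b (f k)) k ≈ when b (sh f k)
  when-sh true  k       = refl
  when-sh false zero    = refl
  when-sh false (suc k) = refl

  module _ {z : Carrier} where

    private
      pull : ∀ (as : List (List ℕ)) p q {f : List ℕ → Bool} →
             ∑ as (λ a → when (p ∧ (q ∧ f a)) z) ≈ when p (when q (∑ as (λ a → when (f a) z)))
      pull as true  true  = refl
      pull as true  false = ∑-0 as
      pull as false q     = ∑-0 as

      pull-map : ∀ g (as : List (List ℕ)) p q {h f : List ℕ → Bool} → (∀ a → h (g a) ≡ p ∧ (q ∧ f a)) →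
                 ∑ (map g as) (λ a → when (h a) z) ≈ when p (when q (∑ as (λ a → when (f a) z)))
      pull-map g as p q eq = trans (∑-map g as)
        (trans (∑-cong as (λ a → reflexive (≡.cong (λ b → when b z) (eq a)))) (pull as p q))

    up-∷ : ∀ b l λs r ρ k → up z b (l ∷ λs) (r ∷ ρ) k ≈
           when (l ≤ᵇ b) (when (r ≤ᵇ l) (up z r λs ρ k)) +
           when (suc l ≤ᵇ b) (when (r ≤ᵇ suc l) (sh (up z r λs ρ) k))
    up-∷ b l λs r ρ k = trans (∑-++ (map (l ∷_) (addStrip λs k))) (+-cong
      (pull-map (l ∷_) (addStrip λs k) (l ≤ᵇ b) (r ≤ᵇ l) (λ _ → ≡.refl))
      (trans (pull-map (suc l ∷_) (shᴸ (addStrip λs) k) (suc l ≤ᵇ b) (r ≤ᵇ suc l) (λ _ → ≡.refl))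
        (when-cong (suc l ≤ᵇ b) (λ _ → when-cong (r ≤ᵇ suc l) (λ _ → ∑-shᴸ (addStrip λs) k)))))

    down-zero : ∀ b l λs ρ k → down z b (l ∷ λs) (0 ∷ ρ) k ≈ when (l ≤ᵇ b) (down z 0 λs ρ k)
    down-zero b l λs ρ k = pull-map (0 ∷_) (delStrip ρ k) (l ≤ᵇ b) true (λ _ → ≡.refl)

    down-suc : ∀ b l λs r ρ k → down z b (l ∷ λs) (suc r ∷ ρ) k ≈
               when (l ≤ᵇ b) (when (suc r ≤ᵇ l) (down z (suc r) λs ρ k)) +
               when (l ≤ᵇ b) (when (r ≤ᵇ l) (sh (down z r λs ρ) k))
    down-suc b l λs r ρ k = trans (∑-++ (map (suc r ∷_) (delStrip ρ k))) (+-cong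
      (pull-map (suc r ∷_) (delStrip ρ k) (l ≤ᵇ b) (suc r ≤ᵇ l) (λ _ → ≡.refl))
      (trans (pull-map (r ∷_) (shᴸ (delStrip ρ) k) (l ≤ᵇ b) (r ≤ᵇ l) (λ _ → ≡.refl))
        (when-cong (l ≤ᵇ b) (λ _ → when-cong (r ≤ᵇ l) (λ _ → ∑-shᴸ (delStrip ρ) k)))))

    up-vanish : ∀ {b} λs ρ k → length λs ≡ length ρ → b < head₀ λs → up z b λs ρ k ≈ 0#
    up-vanish {b} (l ∷ λs) (r ∷ ρ) k _ b<l = trans (up-∷ b l λs r ρ k) (trans
      (+-cong (when-false (≤ᵇ-false b<l)) (when-false (≤ᵇ-false (m≤n⇒m≤1+n b<l))))
      (+-identityˡ 0#))

    down-vanish : ∀ {b} λs ρ k → b < head₀ λs → down z b λs ρ k ≈ 0#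
    down-vanish λs ρ k b<l = trans (∑-cong (delStrip ρ k) λ μ →
      when-false (interlace-vanish λs μ b<l)) (∑-0 (delStrip ρ k))

    down-bound : ∀ {b b′} λs ρ k → head₀ λs ≤ b → head₀ λs ≤ b′ → down z b λs ρ k ≈ down z b′ λs ρ k
    down-bound λs ρ k l≤b l≤b′ = ∑-cong (delStrip ρ k) λ μ →
      reflexive (≡.cong (λ p → when p z) (interlace-bound λs μ l≤b l≤b′))

    private
      sh-0 : ∀ {f} → (∀ k → f k ≈ 0#) → ∀ k → sh f k ≈ 0#
      sh-0 f≈0 zero    = refl
      sh-0 f≈0 (suc k) = f≈0 k

      when₂-0 : ∀ p q {r} → r ≈ 0# → when p (when q r) ≈ 0#
      when₂-0 p q r≈0 = trans (when-cong p λ _ → trans (when-cong q λ _ → r≈0) (when-0 q)) (when-0 p)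

    module _ {b l r : ℕ} (λs ρ : List ℕ) (l≤b : l ≤ b) where

      -- The first row of the intermediate shape is r, or r - 1 if it is raised, and must be at
      -- least the second part h of λ. Both choices survive for h < r, only r for h = r, none for h
      -- > r.
      down-< : head₀ λs < r → ∀ k → down z b (l ∷ λs) (r ∷ ρ) k ≈
               when (r ≤ᵇ l) (down z r λs ρ k) + when (r ≤ᵇ suc l) (sh (down z r λs ρ) k)
      down-< (s≤s {n = r′} h≤r′) k = trans (down-suc b l λs r′ ρ k) (+-cong
        (when-true (≤ᵇ-true l≤b))
        (trans (reflexive (≡.cong₂ (λ p q → when p (when q (sh (down z r′ λs ρ) k)))
                                   (≤ᵇ-true l≤b) (≡.sym (≤ᵇ-suc r′ l))))
               (when-cong (suc r′ ≤ᵇ suc l) λ _ →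
                  sh-cong (λ k → down-bound λs ρ k h≤r′ (m≤n⇒m≤1+n h≤r′)) k)))

      down-≡ : head₀ λs ≡ r → r ≤ l → ∀ k → down z b (l ∷ λs) (r ∷ ρ) k ≈ down z r λs ρ k
      down-≡ h≡r r≤l k = go r h≡r r≤l
        where
        go : ∀ r → head₀ λs ≡ r → r ≤ l → down z b (l ∷ λs) (r ∷ ρ) k ≈ down z r λs ρ k
        go zero    _   _   = trans (down-zero b l λs ρ k)
          (when-true (≤ᵇ-true l≤b))
        go (suc r) h≡r r≤l = trans (down-suc b l λs r ρ k) (trans (+-cong
          (trans (when-true (≤ᵇ-true l≤b)) (when-true (≤ᵇ-true r≤l)))
          (when₂-0 (l ≤ᵇ b) (r ≤ᵇ l) (sh-0 (λ k → down-vanish λs ρ k (ℕₚ.≤-reflexive (≡.sym h≡r))) k)))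
          (+-identityʳ _))

      down-> : r < head₀ λs → ∀ k → down z b (l ∷ λs) (r ∷ ρ) k ≈ 0#
      down-> r<h k = go r r<h
        where
        go : ∀ r → r < head₀ λs → down z b (l ∷ λs) (r ∷ ρ) k ≈ 0#
        go zero    r<h = trans (down-zero b l λs ρ k)
          (trans (when-cong (l ≤ᵇ b) λ _ → down-vanish λs ρ k r<h) (when-0 (l ≤ᵇ b)))
        go (suc r) r<h = trans (down-suc b l λs r ρ k) (trans (+-cong
          (when₂-0 (l ≤ᵇ b) (suc r ≤ᵇ l) (down-vanish λs ρ k r<h))
          (when₂-0 (l ≤ᵇ b) (r ≤ᵇ l) (sh-0 (λ k → down-vanish λs ρ k (<⇒≤ r<h)) k)))
          (+-identityʳ _))

    up-< : ∀ {b l r} λs ρ → l < b → ∀ k → up z b (l ∷ λs) (r ∷ ρ) k ≈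
           when (r ≤ᵇ l) (up z r λs ρ k) + when (r ≤ᵇ suc l) (sh (up z r λs ρ) k)
    up-< {b} {l} {r} λs ρ l<b k = trans (up-∷ b l λs r ρ k) (+-cong
      (when-true (≤ᵇ-true (<⇒≤ l<b))) (when-true (≤ᵇ-true l<b)))

    up-≡ : ∀ {l r} λs ρ → r ≤ l → ∀ k → up z l (l ∷ λs) (r ∷ ρ) k ≈ up z r λs ρ k
    up-≡ {l} {r} λs ρ r≤l k = trans (up-∷ l l λs r ρ k) (trans (+-cong
      (trans (when-true (≤ᵇ-true {l} ≤-refl)) (when-true (≤ᵇ-true r≤l)))
      (when-false (≤ᵇ-false {suc l} ≤-refl)))
      (+-identityʳ _))

    -- Let h be the first part of λs, and q the shift of sequences:
    -- up = (1 + q) down if h < b, and up = down if h = b.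
    exchange-< : ∀ {b} λs ρ → length λs ≡ length ρ → Desc b λs → Desc₀ b ρ → head₀ λs < b →
                 ∀ k → up z b λs ρ k ≈ down z b λs ρ k + sh (down z b λs ρ) k
    exchange-≡ : ∀ {b} λs ρ → length λs ≡ length ρ → Desc b λs → Desc₀ b ρ → head₀ λs ≡ b →
                 ∀ k → up z b λs ρ k ≈ down z b λs ρ k

    exchange-< []       []      _    _ []        ()
    exchange-< {b} (l ∷ λs) (r ∷ ρ) |λ|≡|ρ| (l≤b ∷ dλ) (r≤b ∷ dρ) l<b k with <-cmp (head₀ λs) r
    ... | tri< h<r _ _ = begin
      up z b (l ∷ λs) (r ∷ ρ) k
        ≈⟨ up-< λs ρ l<b k ⟩
      when (r ≤ᵇ l) (up z r λs ρ k) + when (r ≤ᵇ suc l) (sh (up z r λs ρ) k)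
        ≈⟨ +-cong (when-cong (r ≤ᵇ l) λ _ → ih k)
                  (when-cong (r ≤ᵇ suc l) λ _ → trans (sh-cong ih k) (sh-+ k)) ⟩
      when (r ≤ᵇ l) (d k + sh d k) + when (r ≤ᵇ suc l) (sh d k + sh (sh d) k)
        ≈⟨ +-cong (when-+ (r ≤ᵇ l)) (when-+ (r ≤ᵇ suc l)) ⟩
      (when (r ≤ᵇ l) (d k) + when (r ≤ᵇ l) (sh d k)) +
      (when (r ≤ᵇ suc l) (sh d k) + when (r ≤ᵇ suc l) (sh (sh d) k))
        ≈⟨ interchange _ _ _ _ ⟩
      (when (r ≤ᵇ l) (d k) + when (r ≤ᵇ suc l) (sh d k)) +
      (when (r ≤ᵇ l) (sh d k) + when (r ≤ᵇ suc l) (sh (sh d) k))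
        ≈⟨ +-congˡ (trans (sh-+ k) (+-cong (when-sh (r ≤ᵇ l) k) (when-sh (r ≤ᵇ suc l) k))) ⟨
      (when (r ≤ᵇ l) (d k) + when (r ≤ᵇ suc l) (sh d k)) +
      sh (λ k → when (r ≤ᵇ l) (d k) + when (r ≤ᵇ suc l) (sh d k)) k
        ≈⟨ +-cong (down-< λs ρ l≤b h<r k) (sh-cong (down-< λs ρ l≤b h<r) k) ⟨
      down z b (l ∷ λs) (r ∷ ρ) k + sh (down z b (l ∷ λs) (r ∷ ρ)) k ∎
      where
      d : ℕ → Carrier
      d = down z r λs ρ
      ih : ∀ k → up z r λs ρ k ≈ d k + sh d k
      ih = exchange-< λs ρ (ℕₚ.suc-injective |λ|≡|ρ|) (rebound (<⇒≤ h<r) dλ) dρ h<r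
    -- The lower rows carry no factor here; 1 + q comes from the two choices l and l + 1 for the
    -- first part of the enlarged shape.
    ... | tri≈ _ h≡r _ = begin
      up z b (l ∷ λs) (r ∷ ρ) k
        ≈⟨ up-< λs ρ l<b k ⟩
      when (r ≤ᵇ l) (up z r λs ρ k) + when (r ≤ᵇ suc l) (sh (up z r λs ρ) k)
        ≈⟨ +-cong (when-true (≤ᵇ-true r≤l)) (when-true (≤ᵇ-true (m≤n⇒m≤1+n r≤l))) ⟩
      up z r λs ρ k + sh (up z r λs ρ) k
        ≈⟨ +-cong (ih k) (sh-cong ih k) ⟩
      down z r λs ρ k + sh (down z r λs ρ) k
        ≈⟨ +-cong (down-≡ λs ρ l≤b h≡r r≤l k) (sh-cong (down-≡ λs ρ l≤b h≡r r≤l) k) ⟨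
      down z b (l ∷ λs) (r ∷ ρ) k + sh (down z b (l ∷ λs) (r ∷ ρ)) k ∎
      where
      r≤l : r ≤ l
      r≤l = ≡.subst (_≤ l) h≡r (desc-head dλ)
      ih : ∀ k → up z r λs ρ k ≈ down z r λs ρ k
      ih = exchange-≡ λs ρ (ℕₚ.suc-injective |λ|≡|ρ|) (rebound (ℕₚ.≤-reflexive h≡r) dλ) dρ h≡r
    ... | tri> _ _ r<h = begin
      up z b (l ∷ λs) (r ∷ ρ) k
        ≈⟨ up-< λs ρ l<b k ⟩
      when (r ≤ᵇ l) (up z r λs ρ k) + when (r ≤ᵇ suc l) (sh (up z r λs ρ) k)
        ≈⟨ +-cong (trans (when-cong (r ≤ᵇ l) λ _ → u≈0 k) (when-0 (r ≤ᵇ l)))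
                  (trans (when-cong (r ≤ᵇ suc l) λ _ → sh-0 u≈0 k) (when-0 (r ≤ᵇ suc l))) ⟩
      0# + 0#
        ≈⟨ +-cong (down-> λs ρ l≤b r<h k) (sh-0 (down-> λs ρ l≤b r<h) k) ⟨
      down z b (l ∷ λs) (r ∷ ρ) k + sh (down z b (l ∷ λs) (r ∷ ρ)) k ∎
      where
      u≈0 : ∀ k → up z r λs ρ k ≈ 0#
      u≈0 k = up-vanish λs ρ k (ℕₚ.suc-injective |λ|≡|ρ|) r<h

    exchange-≡ []       []      _    _ []        _ zero    = refl
    exchange-≡ []       []      _    _ []        _ (suc k) = refl
    exchange-≡ (l ∷ λs) (r ∷ ρ) |λ|≡|ρ| (l≤b ∷ dλ) (r≤l ∷ dρ) ≡.refl k with <-cmp (head₀ λs) r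
    -- The bound forbids l + 1, so the factor 1 + q of the lower rows must match the two choices r
    -- and r - 1 on the side of `down`.
    ... | tri< h<r _ _ = begin
      up z l (l ∷ λs) (r ∷ ρ) k
        ≈⟨ up-≡ λs ρ r≤l k ⟩
      up z r λs ρ k
        ≈⟨ exchange-< λs ρ (ℕₚ.suc-injective |λ|≡|ρ|) (rebound (<⇒≤ h<r) dλ) dρ h<r k ⟩
      down z r λs ρ k + sh (down z r λs ρ) k
        ≈⟨ +-cong (when-true (≤ᵇ-true r≤l)) (when-true (≤ᵇ-true (m≤n⇒m≤1+n r≤l))) ⟨
      when (r ≤ᵇ l) (down z r λs ρ k) + when (r ≤ᵇ suc l) (sh (down z r λs ρ) k)
        ≈⟨ down-< λs ρ l≤b h<r k ⟨
      down z l (l ∷ λs) (r ∷ ρ) k ∎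
    ... | tri≈ _ h≡r _ = begin
      up z l (l ∷ λs) (r ∷ ρ) k
        ≈⟨ up-≡ λs ρ r≤l k ⟩
      up z r λs ρ k
        ≈⟨ exchange-≡ λs ρ (ℕₚ.suc-injective |λ|≡|ρ|) (rebound (ℕₚ.≤-reflexive h≡r) dλ) dρ h≡r k ⟩
      down z r λs ρ k
        ≈⟨ down-≡ λs ρ l≤b h≡r r≤l k ⟨
      down z l (l ∷ λs) (r ∷ ρ) k ∎
    ... | tri> _ _ r<h = begin
      up z l (l ∷ λs) (r ∷ ρ) k
        ≈⟨ up-≡ λs ρ r≤l k ⟩
      up z r λs ρ k
        ≈⟨ up-vanish λs ρ k (ℕₚ.suc-injective |λ|≡|ρ|) r<h ⟩
      0#
        ≈⟨ down-> λs ρ l≤b r<h k ⟨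
      down z l (l ∷ λs) (r ∷ ρ) k ∎

-- Schur polynomials and the dual Pieri rule

allZero : List ℕ → Bool
allZero []          = true
allZero (zero ∷ λs) = allZero λs
allZero (suc _ ∷ _) = false

allZero-sum : ∀ λs → allZero λs ≡ true → sum λs ≡ 0
allZero-sum []          _  = ≡.refl
allZero-sum (zero ∷ λs) eq = allZero-sum λs eq

allZero-desc : ∀ b λs → allZero λs ≡ true → Desc b λs
allZero-desc b []          _  = []
allZero-desc b (zero ∷ λs) eq = z≤n ∷ allZero-desc 0 λs eq

Any-sum : ∀ {n} ρ → Any (n ≤_) ρ → n ≤ sum ρ
Any-sum (r ∷ ρ) (here n≤r)  = ≤-trans n≤r (ℕₚ.m≤m+n r (sum ρ))
Any-sum (r ∷ ρ) (there any) = ≤-trans (Any-sum ρ any) (ℕₚ.m≤n+m (sum ρ) r)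

module SchurPolynomials {c ℓ} (R : CommutativeSemiring c ℓ)
  (+-cancelˡ : LeftCancellative (CommutativeSemiring._≈_ R) (CommutativeSemiring._+_ R))
  (x : ℕ → CommutativeSemiring.Carrier R) (N : ℕ) where
  open CommutativeSemiring R hiding (zero)
  open ListSum R
  open Sequences R
  open StripExchange R
  open PathPolynomials R +-cancelˡ x
  open import Relation.Binary.Reasoning.Setoid setoid
  open import Algebra.Properties.Semiring.Exp semiring using (_^_; ^-congʳ)
  open import Algebra.Properties.CommutativeSemigroup *-commutativeSemigroup
    using () renaming (x∙yz≈y∙xz to x*yz≈y*xz)

  -- The Schur polynomial in x₀ , … , xₘ₋₁ by branching, for shapes with all parts at most N;
  -- it vanishes when λs is not weakly decreasing.
  s : ℕ → List ℕ → Carrier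
  s zero    λs = when (allZero λs) 1#
  s (suc m) λs = ∑ (words (suc N) (length λs)) λ ρ →
                   when (interlace (suc N) λs ρ) (x m ^ (sum λs ∸ sum ρ) * s m ρ)

  -- This makes the lists produced by `addStrip` that are not partitions harmless.
  s-vanish : ∀ m λs → ¬ Desc (suc N) λs → s m λs ≈ 0#
  s-vanish zero    λs ¬d with allZero λs in eq
  ... | true  = ⊥-elim (¬d (allZero-desc _ λs eq))
  ... | false = refl
  s-vanish (suc m) λs ¬d = trans (∑-cong (words (suc N) (length λs)) vanish) (∑-0 (words (suc N) (length λs)))
    where
    vanish : ∀ ρ → when (interlace (suc N) λs ρ) (x m ^ (sum λs ∸ sum ρ) * s m ρ) ≈ 0#
    vanish ρ with interlace (suc N) λs ρ in eq
    ... | true  = ⊥-elim (¬d (interlace-desc (suc N) λs ρ eq))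
    ... | false = refl

  -- Double counting of pairs (μ, ρ) whose difference is a vertical strip. Entries range over 0,
  -- ..., N, so raising an entry N would leave the range; hence the condition on g.
  strip-flip : ∀ n {g : List ℕ → List ℕ → Carrier} →
               (∀ μ ρ → Any (N ≤_) μ → g μ ρ ≈ 0#) → ∀ j →
               ∑ (words (suc N) n) (λ μ → ∑ (addStrip μ j) (g μ)) ≈
               ∑ (words (suc N) n) (λ ρ → ∑ (delStrip ρ j) (λ μ → g μ ρ))
  strip-flip zero    g≈0 zero    = refl
  strip-flip zero    g≈0 (suc j) = refl
  strip-flip (suc n) {g} g≈0 j = begin
    ∑ (words (suc N) (suc n)) (λ μ → ∑ (addStrip μ j) (g μ))
      ≈⟨ ∑-words (suc N) n ⟩
    ∑< (suc N) (λ l → ∑ W (λ μ → ∑ (addStrip (l ∷ μ) j) (g (l ∷ μ))))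
      ≈⟨ ∑-cong (upTo (suc N)) (λ l → trans (∑-cong W (λ μ → trans
           (∑-++ (map (l ∷_) (addStrip μ j)))
           (+-cong (∑-map (l ∷_) (addStrip μ j)) (∑-map (suc l ∷_) (shᴸ (addStrip μ) j)))))
           (∑-+ W)) ⟩
    ∑< (suc N) (λ l → ∑ W (λ μ → ∑ (addStrip μ j) (g (l ∷ μ) ∘ (l ∷_))) +
                      ∑ W (λ μ → ∑ (shᴸ (addStrip μ) j) (g (l ∷ μ) ∘ (suc l ∷_))))
      ≈⟨ ∑-cong (upTo (suc N)) (λ l → +-cong
           (strip-flip n (λ μ ρ any → g≈0 (l ∷ μ) (l ∷ ρ) (there any)) j) (flip₁ l j)) ⟩
    ∑< (suc N) (λ l → G₀ l + G₁ l)
      ≈⟨ ∑-+ (upTo (suc N)) ⟩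
    ∑< (suc N) G₀ + ∑< (suc N) G₁
      ≈⟨ +-cong (∑<-first N) (∑<-last N) ⟩
    (G₀ 0 + ∑< N (G₀ ∘ suc)) + (∑< N G₁ + G₁ N)
      -- Raising pairs the entry l of μ with the entry l + 1 of ρ, so dropping l = N aligns the two
      -- index ranges.
      ≈⟨ +-congˡ (trans (+-congˡ G₁N≈0) (+-identityʳ _)) ⟩
    (G₀ 0 + ∑< N (G₀ ∘ suc)) + ∑< N G₁
      ≈⟨ trans (+-assoc _ _ _) (+-congˡ (sym (∑-+ (upTo N)))) ⟩
    G₀ 0 + ∑< N (λ r → G₀ (suc r) + G₁ r)
      ≈⟨ +-cong (∑-cong W (λ ρ → ∑-map (0 ∷_) (delStrip ρ j)))
           (∑-cong (upTo N) (λ r → trans (∑-cong W (λ ρ → trans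
             (∑-++ (map (suc r ∷_) (delStrip ρ j)))
             (+-cong (∑-map (suc r ∷_) (delStrip ρ j)) (∑-map (r ∷_) (shᴸ (delStrip ρ) j)))))
             (∑-+ W))) ⟨
    ∑ W (λ ρ → ∑ (delStrip (0 ∷ ρ) j) (λ μ → g μ (0 ∷ ρ))) +
    ∑< N (λ r → ∑ W (λ ρ → ∑ (delStrip (suc r ∷ ρ) j) (λ μ → g μ (suc r ∷ ρ))))
      ≈⟨ ∑<-first N ⟨
    ∑< (suc N) (λ r → ∑ W (λ ρ → ∑ (delStrip (r ∷ ρ) j) (λ μ → g μ (r ∷ ρ))))
      ≈⟨ ∑-words (suc N) n ⟨
    ∑ (words (suc N) (suc n)) (λ ρ → ∑ (delStrip ρ j) (λ μ → g μ ρ)) ∎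
    where
    W = words (suc N) n
    G₀ G₁ : ℕ → Carrier
    G₀ l = ∑ W (λ ρ → ∑ (delStrip ρ j) (λ μ → g (l ∷ μ) (l ∷ ρ)))
    G₁ l = ∑ W (λ ρ → ∑ (shᴸ (delStrip ρ) j) (λ μ → g (l ∷ μ) (suc l ∷ ρ)))
    flip₁ : ∀ l j → ∑ W (λ μ → ∑ (shᴸ (addStrip μ) j) (g (l ∷ μ) ∘ (suc l ∷_))) ≈
                    ∑ W (λ ρ → ∑ (shᴸ (delStrip ρ) j) (λ μ → g (l ∷ μ) (suc l ∷ ρ)))
    flip₁ l zero    = refl
    flip₁ l (suc j) = strip-flip n (λ μ ρ any → g≈0 (l ∷ μ) (suc l ∷ ρ) (there any)) j
    G₁N≈0 : G₁ N ≈ 0#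
    G₁N≈0 = trans (∑-cong W (λ ρ → trans
      (∑-cong (shᴸ (delStrip ρ) j) (λ μ → g≈0 (N ∷ μ) (suc N ∷ ρ) (here ≤-refl)))
      (∑-0 (shᴸ (delStrip ρ) j)))) (∑-0 W)

  up-0 : ∀ {z b} λs ρ k → z ≈ 0# → up z b λs ρ k ≈ 0#
  up-0 {z} {b} λs ρ k z≈0 = trans (∑-cong (addStrip λs k) λ ν →
    trans (when-cong (interlace b ν ρ) λ _ → z≈0) (when-0 (interlace b ν ρ))) (∑-0 (addStrip λs k))

  down-0 : ∀ {z b} λs ρ k → z ≈ 0# → down z b λs ρ k ≈ 0#
  down-0 {z} {b} λs ρ k z≈0 = trans (∑-cong (delStrip ρ k) λ μ →
    trans (when-cong (interlace b λs μ) λ _ → z≈0) (when-0 (interlace b λs μ))) (∑-0 (delStrip ρ k))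

  up-big : ∀ {z b} λs ρ k → sum λs ℕ.+ k < sum ρ → up z b λs ρ k ≈ 0#
  up-big {z} {b} λs ρ k big = trans (∑-All (addStrip-All λs k) vanish) (∑-0 (addStrip λs k))
    where
    vanish : ∀ ν → (length ν ≡ length λs) & (sum ν ≡ sum λs ℕ.+ k) → when (interlace b ν ρ) z ≈ 0#
    vanish ν (_ , |ν|) with interlace b ν ρ in eq
    ... | true  = ⊥-elim (<⇒≱ big (≡.subst (sum ρ ≤_) |ν| (interlace-sum b ν ρ eq)))
    ... | false = refl

  down-big : ∀ {z b} λs ρ k → sum λs ℕ.+ k < sum ρ → down z b λs ρ k ≈ 0#
  down-big {z} {b} λs ρ k big = trans (∑-All (delStrip-All ρ k) vanish) (∑-0 (delStrip ρ k))
    where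
    vanish : ∀ μ → sum ρ ≡ sum μ ℕ.+ k → when (interlace b λs μ) z ≈ 0#
    vanish μ |ρ| with interlace b λs μ in eq
    ... | true  = ⊥-elim (<⇒≱ big (≡.subst (_≤ sum λs ℕ.+ k) (≡.sym |ρ|)
                                      (ℕₚ.+-monoˡ-≤ k (interlace-sum b λs μ eq))))
    ... | false = refl

  module _ (m : ℕ) where

    weight : ℕ → List ℕ → Carrier
    weight n ρ = x m ^ (n ∸ sum ρ) * s m ρ

    -- If ρ is not weakly decreasing its weight is 0; if it has more than |λ| + k boxes no
    -- intermediate shape exists. Otherwise |ρ| < N leaves its last row empty and `exchange-<`
    -- applies.
    exchange : ∀ λs k → Desc (suc N) λs → length λs ≡ N → sum λs ℕ.+ k < N →
               ∀ ρ → length ρ ≡ N → let z = weight (sum λs ℕ.+ k) ρ in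
               up z (suc N) λs ρ k ≈ down z (suc N) λs ρ k + sh (down z (suc N) λs ρ) k
    exchange λs k dλ |λ| small ρ |ρ| with desc? (suc N) ρ
    ... | no ¬d = trans (up-0 λs ρ k z≈0) (sym (trans (+-cong (down-0 λs ρ k z≈0) (shifted k)) (+-identityˡ 0#)))
      where
      z≈0 : weight (sum λs ℕ.+ k) ρ ≈ 0#
      z≈0 = trans (*-congˡ (s-vanish m ρ ¬d)) (zeroʳ _)
      shifted : ∀ j → sh (down (weight (sum λs ℕ.+ k) ρ) (suc N) λs ρ) j ≈ 0#
      shifted zero    = refl
      shifted (suc j) = down-0 λs ρ j z≈0
    ... | yes d with sum λs ℕ.+ k <? sum ρ
    ...   | yes big = trans (up-big λs ρ k big) (sym (trans (+-cong (down-big λs ρ k big) (shifted k big)) (+-identityˡ 0#)))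
      where
      shifted : ∀ j → sum λs ℕ.+ j < sum ρ → sh (down (weight (sum λs ℕ.+ k) ρ) (suc N) λs ρ) j ≈ 0#
      shifted zero    _   = refl
      shifted (suc j) big = down-big λs ρ j (<⇒≤ (≡.subst (_< sum ρ) (ℕₚ.+-suc (sum λs) j) big))
    ...   | no ¬big = exchange-< λs ρ (≡.trans |λ| (≡.sym |ρ|)) dλ
      (desc⇒desc₀ d (≡.subst (sum ρ <_) (≡.sym |ρ|) (ℕₚ.≤-<-trans (≮⇒≥ ¬big) small)))
      (head< λs (ℕₚ.≤-<-trans (ℕₚ.m≤m+n (sum λs) k) small)) k
      where
      head< : ∀ λs → sum λs < N → head₀ λs < suc N
      head< []       _ = z<s
      head< (l ∷ λs) lt = m≤n⇒m≤1+n (ℕₚ.≤-<-trans (ℕₚ.m≤m+n l (sum λs)) lt)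

    module _ (ih : ∀ λs k → Desc (suc N) λs → length λs ≡ N → sum λs ℕ.+ k < N →
                   e m k * s m λs ≈ ∑ (addStrip λs k) (s m)) where

      -- Pieri in m variables is applied to every μ in the branching of λ, and the sums are flipped.
      -- Here d is the number of factors x_m taken from the elementary polynomial, 0 or 1; the
      -- exponent of x_m then depends only on ρ and the total degree.
      branch-down : ∀ d λs j → length λs ≡ N → sum λs ℕ.+ j < N →
        ∑ (words (suc N) N) (λ μ → when (interlace (suc N) λs μ)
             (x m ^ (d ℕ.+ (sum λs ∸ sum μ)) * (e m j * s m μ))) ≈
        ∑ (words (suc N) N) (λ ρ → down (weight (sum λs ℕ.+ (d ℕ.+ j)) ρ) (suc N) λs ρ j)
      branch-down d λs j |λ| small = trans (∑-words-cong (suc N) N λ μ |μ| _ → begin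
        when (interlace (suc N) λs μ) (x m ^ (d ℕ.+ (sum λs ∸ sum μ)) * (e m j * s m μ))
          ≈⟨ when-cong (interlace (suc N) λs μ) (λ eq → *-congˡ (ih μ j (interlace-descʳ (suc N) λs μ eq) |μ|
               (ℕₚ.≤-<-trans (ℕₚ.+-monoˡ-≤ j (interlace-sum (suc N) λs μ eq)) small))) ⟩
        when (interlace (suc N) λs μ) (x m ^ (d ℕ.+ (sum λs ∸ sum μ)) * ∑ (addStrip μ j) (s m))
          ≈⟨ when-cong (interlace (suc N) λs μ) (λ eq → trans (*-∑ _ (addStrip μ j))
               (∑-All (addStrip-All μ j) λ { ρ (_ , |ρ|) → *-congʳ (^-congʳ (x m)
                 (degree d (sum λs) (sum μ) j (interlace-sum (suc N) λs μ eq) |ρ|)) })) ⟩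
        when (interlace (suc N) λs μ) (∑ (addStrip μ j) (weight (sum λs ℕ.+ (d ℕ.+ j))))
          ≈⟨ when-∑ (interlace (suc N) λs μ) (addStrip μ j) ⟩
        ∑ (addStrip μ j) (λ ρ → when (interlace (suc N) λs μ) (weight (sum λs ℕ.+ (d ℕ.+ j)) ρ)) ∎)
        (strip-flip N g≈0 j)
        where
        degree : ∀ d l u j {r} → u ≤ l → r ≡ u ℕ.+ j → d ℕ.+ (l ∸ u) ≡ l ℕ.+ (d ℕ.+ j) ∸ r
        degree d l u j u≤l ≡.refl = ≡.sym (≡.trans
          (≡.cong₂ _∸_ (≡.trans (≡.sym (ℕₚ.+-assoc l d j)) (ℕₚ.+-comm (l ℕ.+ d) j)) (ℕₚ.+-comm u j))
          (≡.trans (ℕₚ.[m+n]∸[m+o]≡n∸o j (l ℕ.+ d) u)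
          (≡.trans (≡.cong (_∸ u) (ℕₚ.+-comm l d)) (ℕₚ.+-∸-assoc d u≤l))))
        g≈0 : ∀ μ ρ → Any (N ≤_) μ → when (interlace (suc N) λs μ) (weight (sum λs ℕ.+ (d ℕ.+ j)) ρ) ≈ 0#
        g≈0 μ ρ any with interlace (suc N) λs μ in eq
        ... | false = refl
        ... | true  = ⊥-elim (<⇒≱ (ℕₚ.≤-<-trans (≤-trans (interlace-sum (suc N) λs μ eq)
                        (ℕₚ.m≤m+n (sum λs) j)) small) (Any-sum μ any))

      -- Split off x_m on both sides. The two terms of e (m + 1) k give `down` at k and at k - 1,
      -- the strips added to λ give `up` at k, and `exchange` equates them: the factor 1 + q matches
      -- E gaining 1 + x_m q.
      pieri-step : ∀ λs k → Desc (suc N) λs → length λs ≡ N → sum λs ℕ.+ k < N →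
                   e (suc m) k * s (suc m) λs ≈ ∑ (addStrip λs k) (s (suc m))
      pieri-step λs k dλ |λ| small = begin
        (e m k + x m * sh (e m) k) * s (suc m) λs
          ≈⟨ distribʳ _ _ _ ⟩
        e m k * s (suc m) λs + x m * sh (e m) k * s (suc m) λs
          ≈⟨ +-cong part₀ (part₁ k small) ⟩
        ∑ W (λ ρ → down (z ρ) (suc N) λs ρ k) + ∑ W (λ ρ → sh (down (z ρ) (suc N) λs ρ) k)
          ≈⟨ ∑-+ W ⟨
        ∑ W (λ ρ → down (z ρ) (suc N) λs ρ k + sh (down (z ρ) (suc N) λs ρ) k)
          ≈⟨ ∑-words-cong (suc N) N (λ ρ |ρ| _ → exchange λs k dλ |λ| small ρ |ρ|) ⟨
        ∑ W (λ ρ → up (z ρ) (suc N) λs ρ k)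
          ≈⟨ ∑-swap W (addStrip λs k) ⟩
        ∑ (addStrip λs k) (λ ν → ∑ W (λ ρ → when (interlace (suc N) ν ρ) (z ρ)))
          ≈⟨ ∑-All (addStrip-All λs k) (λ { ν (|ν| , Σν) → reflexive (≡.cong₂
               (λ n d → ∑ (words (suc N) n) (λ ρ → when (interlace (suc N) ν ρ) (weight d ρ)))
               (≡.trans (≡.sym |λ|) (≡.sym |ν|)) (≡.sym Σν)) }) ⟩
        ∑ (addStrip λs k) (s (suc m)) ∎
        where
        W = words (suc N) N
        z = weight (sum λs ℕ.+ k)
        unfold : ∀ r → r * s (suc m) λs ≈
          ∑ W (λ μ → when (interlace (suc N) λs μ) (r * (x m ^ (sum λs ∸ sum μ) * s m μ)))
        unfold r rewrite |λ| = trans (*-∑ r W) (∑-cong W λ μ → *-when (interlace (suc N) λs μ))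
        part₀ : e m k * s (suc m) λs ≈ ∑ W (λ ρ → down (z ρ) (suc N) λs ρ k)
        part₀ = trans (unfold (e m k)) (trans (∑-cong W λ μ → when-cong (interlace (suc N) λs μ) λ _ →
          x*yz≈y*xz _ _ _) (branch-down 0 λs k |λ| small))
        part₁ : ∀ k → sum λs ℕ.+ k < N → x m * sh (e m) k * s (suc m) λs ≈
                ∑ W (λ ρ → sh (down (weight (sum λs ℕ.+ k) ρ) (suc N) λs ρ) k)
        part₁ zero    _ = trans (*-congʳ (zeroʳ _)) (trans (zeroˡ _) (sym (∑-0 W)))
        part₁ (suc k) small = trans (unfold (x m * e m k)) (trans (∑-cong W λ μ →
          when-cong (interlace (suc N) λs μ) λ _ → trans (*-assoc _ _ _)
            (trans (*-congˡ (x*yz≈y*xz _ _ _)) (sym (*-assoc _ _ _))))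
          (branch-down 1 λs k |λ| (<⇒≤ (≡.subst (_< N) (ℕₚ.+-suc (sum λs) k) small))))

  pieri : ∀ m λs k → Desc (suc N) λs → length λs ≡ N → sum λs ℕ.+ k < N →
          e m k * s m λs ≈ ∑ (addStrip λs k) (s m)
  pieri zero λs zero    _ _ _ = trans (*-identityˡ _)
    (trans (sym (+-identityʳ _)) (reflexive (≡.cong (λ as → ∑ as (s 0)) (≡.sym (addStrip-zero λs)))))
  pieri zero λs (suc k) _ _ _ = trans (zeroˡ _)
    (sym (trans (∑-All (addStrip-All λs (suc k)) vanish) (∑-0 (addStrip λs (suc k)))))
    where
    vanish : ∀ ν → (length ν ≡ length λs) & (sum ν ≡ sum λs ℕ.+ suc k) → s 0 ν ≈ 0#
    vanish ν (_ , Σν) with allZero ν in eq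
    ... | false = refl
    ... | true with ≡.trans (≡.sym (allZero-sum ν eq)) (≡.trans Σν (ℕₚ.+-suc (sum λs) k))
    ...   | ()
  pieri (suc m) = pieri-step m (pieri m)

-- The cone of Schur positive polynomials

module SchurCone {c ℓ} (R : CommutativeSemiring c ℓ)
  (+-cancelˡ : LeftCancellative (CommutativeSemiring._≈_ R) (CommutativeSemiring._+_ R))
  (x : ℕ → CommutativeSemiring.Carrier R) (N′ : ℕ) where
  open CommutativeSemiring R hiding (zero)
  open ListSum R
  open Sequences R
  open PathPolynomials R +-cancelˡ x
  open import Relation.Binary.Reasoning.Setoid setoid

  N : ℕ
  N = suc N′

  open SchurPolynomials R +-cancelˡ x N

  Shape : ℕ → List ℕ → Set
  Shape d μ = Desc (suc N) μ & (length μ ≡ N) & (sum μ ≡ d)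

  -- Since d < N, such shapes have an empty last row: adding strips never runs out of rows.
  SP : ℕ → (ℕ → Carrier) → Set ℓ
  SP d f = d < N → Σ (List (List ℕ)) λ Λ → All (Shape d) Λ & (∀ m → f m ≈ ∑ Λ (s m))

  private variable
    d d′ : ℕ
    f g  : ℕ → Carrier

  -- Restores the condition `Shape` after `addStrip`, at no cost because the removed lists
  -- contribute 0.
  prune : ∀ Λ → All (λ μ → (length μ ≡ N) & (sum μ ≡ d)) Λ →
          Σ (List (List ℕ)) λ Λ′ → All (Shape d) Λ′ & (∀ m → ∑ Λ (s m) ≈ ∑ Λ′ (s m))
  prune []      []       = [] , [] , λ _ → refl
  prune (μ ∷ Λ) (p ∷ ps) with desc? (suc N) μ | prune Λ ps
  ... | yes dμ | Λ′ , all , eq = μ ∷ Λ′ , (dμ , p) ∷ all , λ m → +-congˡ (eq m)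
  ... | no ¬dμ | Λ′ , all , eq = Λ′ , all , λ m →
    trans (+-cong (s-vanish m μ ¬dμ) (eq m)) (+-identityˡ _)

  SP-cong : (∀ m → f m ≈ g m) → SP d f → SP d g
  SP-cong f≈g sp d<N with sp d<N
  ... | Λ , all , eq = Λ , all , λ m → trans (sym (f≈g m)) (eq m)

  SP-deg : d ≡ d′ → SP d f → SP d′ f
  SP-deg ≡.refl sp = sp

  SP-0 : SP d (λ _ → 0#)
  SP-0 _ = [] , [] , λ _ → refl

  SP-+ : SP d f → SP d g → SP d (λ m → f m + g m)
  SP-+ spf spg d<N with spf d<N | spg d<N
  ... | Λ , all , eq | Λ′ , all′ , eq′ =
    Λ ++ Λ′ , ++⁺ all all′ , λ m → trans (+-cong (eq m) (eq′ m)) (sym (∑-++ Λ))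

  SP-× : ∀ n → SP d f → SP d (λ m → n × f m)
  SP-× zero    sp = SP-0
  SP-× (suc n) sp = SP-+ sp (SP-× n sp)

  SP-e* : ∀ k → SP d f → SP (k ℕ.+ d) (λ m → e m k * f m)
  SP-e* {d} {f} k sp k+d<N with sp (ℕₚ.≤-<-trans (ℕₚ.m≤n+m d k) k+d<N)
  ... | Λ , all , eq with prune (concatMap (λ μ → addStrip μ k) Λ) (strips all)
    where
    strips : ∀ {Λ} → All (Shape d) Λ →
             All (λ ν → (length ν ≡ N) & (sum ν ≡ k ℕ.+ d)) (concatMap (λ μ → addStrip μ k) Λ)
    strips []                             = []
    strips (_∷_ {x = μ} (_ , |μ| , Σμ) ps) = ++⁺
      (All.map (λ { (|ν| , Σν) → ≡.trans |ν| |μ| ,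
                                 ≡.trans Σν (≡.trans (≡.cong (ℕ._+ k) Σμ) (ℕₚ.+-comm d k)) })
               (addStrip-All μ k))
      (strips ps)
  ...   | Λ′ , all′ , eq′ = Λ′ , all′ , λ m → begin
    e m k * f m                                 ≈⟨ *-congˡ (eq m) ⟩
    e m k * ∑ Λ (s m)                           ≈⟨ *-∑ (e m k) Λ ⟩
    ∑ Λ (λ μ → e m k * s m μ)                   ≈⟨ ∑-All all (λ { μ (dμ , |μ| , Σμ) → pieri m μ k dμ |μ|
                                                     (≡.subst (_< N) (≡.trans (ℕₚ.+-comm k d) (≡.cong (ℕ._+ k) (≡.sym Σμ))) k+d<N) }) ⟩
    ∑ Λ (λ μ → ∑ (addStrip μ k) (s m))          ≈⟨ ∑-concatMap (λ μ → addStrip μ k) Λ ⟨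
    ∑ (concatMap (λ μ → addStrip μ k) Λ) (s m)  ≈⟨ eq′ m ⟩
    ∑ Λ′ (s m)                                  ∎

  zeros : ℕ → List ℕ
  zeros n = replicate n 0

  sum-zeros : ∀ n → sum (zeros n) ≡ 0
  sum-zeros zero    = ≡.refl
  sum-zeros (suc n) = sum-zeros n

  desc-zeros : ∀ b n → Desc b (zeros n)
  desc-zeros b zero    = []
  desc-zeros b (suc n) = z≤n ∷ desc-zeros 0 n

  ∑-zeros : ∀ b n {F : List ℕ → Carrier} → ∑ (words (suc N) n) (λ ρ → when (interlace b (zeros n) ρ) (F ρ)) ≈ F (zeros n)
  ∑-zeros b zero    = +-identityʳ _
  ∑-zeros b (suc n) {F} = begin
    ∑ (words (suc N) (suc n)) (λ ρ → when (interlace b (zeros (suc n)) ρ) (F ρ))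
      ≈⟨ trans (∑-words (suc N) n) (∑<-first N) ⟩
    ∑ W (λ ρ → when (interlace 0 (zeros n) ρ) (F (0 ∷ ρ))) + ∑< N (λ r → ∑ W (λ ρ → 0#))
      ≈⟨ +-cong (∑-zeros 0 n) (trans (∑-cong (upTo N) (λ _ → ∑-0 W)) (∑-0 (upTo N))) ⟩
    F (zeros (suc n)) + 0#
      ≈⟨ +-identityʳ _ ⟩
    F (zeros (suc n)) ∎
    where W = words (suc N) n

  s-zeros : ∀ m n → s m (zeros n) ≈ 1#
  s-zeros zero n = when-true (go n)
    where
    go : ∀ n → allZero (zeros n) ≡ true
    go zero    = ≡.refl
    go (suc n) = go n
  s-zeros (suc m) n rewrite length-replicate n {0} = trans (∑-zeros (suc N) n)
    (trans (*-cong (^-congʳ (x m) (ℕₚ.n∸n≡0 (sum (zeros n)))) (s-zeros m n)) (*-identityˡ 1#))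
    where open import Algebra.Properties.Semiring.Exp semiring using (^-congʳ)

  SP-1 : SP 0 (λ _ → 1#)
  SP-1 _ = [ zeros N ] , (desc-zeros (suc N) N , length-replicate N , sum-zeros N) ∷ [] ,
           λ m → sym (trans (+-identityʳ _) (s-zeros m N))

  SP-e : ∀ k → SP k (λ m → e m k)
  SP-e k = SP-deg (ℕₚ.+-identityʳ k) (SP-cong (λ m → *-identityʳ _) (SP-e* k SP-1))

  -- Pieri for the empty shape: a strip avoiding the first row would put boxes below an empty row.
  -- The sum contains one partition, the column (1ᵏ⁺¹), but is kept as a sum to be matched termwise
  -- in `e*e₁`.
  e-columns : ∀ m k → suc k < N → e m (suc k) ≈ ∑ (addStrip (zeros N′) k) (s m ∘ (1 ∷_))
  e-columns m k k<N = begin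
    e m (suc k)
      ≈⟨ *-identityʳ _ ⟨
    e m (suc k) * 1#
      ≈⟨ *-congˡ (s-zeros m N) ⟨
    e m (suc k) * s m (zeros N)
      ≈⟨ pieri m (zeros N) (suc k) (desc-zeros (suc N) N) (length-replicate N)
           (≡.subst (λ n → n ℕ.+ suc k < N) (≡.sym (sum-zeros N)) k<N) ⟩
    ∑ (addStrip (zeros N) (suc k)) (s m)
      ≈⟨ ∑-++ (map (0 ∷_) (addStrip (zeros N′) (suc k))) ⟩
    ∑ (map (0 ∷_) (addStrip (zeros N′) (suc k))) (s m) + ∑ (map (1 ∷_) (addStrip (zeros N′) k)) (s m)
      ≈⟨ +-cong (trans (∑-map (0 ∷_) (addStrip (zeros N′) (suc k)))
                (trans (∑-All (addStrip-All (zeros N′) (suc k)) (λ { ν (_ , Σν) → s-vanish m (0 ∷ ν)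
                  λ { (_ ∷ dν) → ℕₚ.1+n≢0 (≡.trans (≡.sym (ℕₚ.+-suc (sum (zeros N′)) k))
                                                     (≡.trans (≡.sym Σν) (desc-zero dν))) } }))
                       (∑-0 (addStrip (zeros N′) (suc k)))))
                (∑-map (1 ∷_) (addStrip (zeros N′) k)) ⟩
    0# + ∑ (addStrip (zeros N′) k) (s m ∘ (1 ∷_))
      ≈⟨ +-identityˡ _ ⟩
    ∑ (addStrip (zeros N′) k) (s m ∘ (1 ∷_)) ∎
    where
    desc-zero : ∀ {ν} → Desc 0 ν → sum ν ≡ 0
    desc-zero []        = ≡.refl
    desc-zero (z≤n ∷ d) = desc-zero d

  -- The Schur polynomial of shape (2, 1ᵏ).
  hook : ℕ → ℕ → Carrier
  hook k m = ∑ (addStrip (zeros N′) k) (s m ∘ (2 ∷_))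

  -- Pieri for a single box: the strips leaving the first row alone give a column, those raising it
  -- give the hook.
  e*e₁ : ∀ m k → 2 ℕ.+ k < N → e m (suc k) * e m 1 ≈ e m (2 ℕ.+ k) + hook k m
  e*e₁ m k k<N = begin
    e m (suc k) * e m 1
      ≈⟨ *-congˡ (trans (e-columns m 0 (≤-trans (s≤s (s≤s z≤n)) k<N))
           (trans (reflexive (≡.cong (λ as → ∑ as (s m ∘ (1 ∷_))) (addStrip-zero (zeros N′)))) (+-identityʳ _))) ⟩
    e m (suc k) * s m (1 ∷ zeros N′)
      ≈⟨ pieri m (1 ∷ zeros N′) (suc k) (s≤s z≤n ∷ desc-zeros 1 N′) (≡.cong suc (length-replicate N′))
           (≡.subst (λ n → suc n ℕ.+ suc k < N) (≡.sym (sum-zeros N′)) k<N) ⟩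
    ∑ (addStrip (1 ∷ zeros N′) (suc k)) (s m)
      ≈⟨ trans (∑-++ (map (1 ∷_) (addStrip (zeros N′) (suc k))))
           (+-cong (∑-map (1 ∷_) (addStrip (zeros N′) (suc k))) (∑-map (2 ∷_) (addStrip (zeros N′) k))) ⟩
    ∑ (addStrip (zeros N′) (suc k)) (s m ∘ (1 ∷_)) + hook k m
      ≈⟨ +-congʳ (e-columns m (suc k) k<N) ⟨
    e m (2 ℕ.+ k) + hook k m ∎

  SP-hook : ∀ k → SP (2 ℕ.+ k) (hook k)
  SP-hook k _ with prune (map (2 ∷_) (addStrip (zeros N′) k)) (map⁺ (All.map
    (λ { (|ν| , Σν) → ≡.cong suc (≡.trans |ν| (length-replicate N′)) ,
                      ≡.cong (2 ℕ.+_) (≡.trans Σν (≡.cong (ℕ._+ k) (sum-zeros N′))) })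
    (addStrip-All (zeros N′) k)))
  ... | Λ , all , eq = Λ , all , λ m → trans (sym (∑-map (2 ∷_) (addStrip (zeros N′) k))) (eq m)

  -- The offset p absorbs index shifts: when `conv` drops the first entry of f, the remaining
  -- sequence has offset p + 1.
  Raises : ℕ → (ℕ → ℕ → Carrier) → Set _
  Raises p f = ∀ j {d h} → SP d h → SP (p ℕ.+ (j ℕ.+ d)) (λ m → f m j * h m)

  SP-conv : ∀ {p q} {f g : ℕ → ℕ → Carrier} n → Raises p f → (∀ i → i ≤ n → SP (q ℕ.+ i) (λ m → g m i)) →
            SP (p ℕ.+ (n ℕ.+ q)) (λ m → conv (f m) (g m) n)
  SP-conv {p} {q} zero    rf spg = SP-deg (≡.cong (p ℕ.+_) (ℕₚ.+-identityʳ q)) (rf 0 (spg 0 z≤n))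
  SP-conv {p} {q} {f} {g} (suc n) rf spg = SP-+
    (SP-deg (≡.cong (p ℕ.+_) (ℕₚ.+-comm q (suc n))) (rf 0 (spg (suc n) ≤-refl)))
    (SP-deg (≡.sym (ℕₚ.+-suc p (n ℕ.+ q)))
      (SP-conv {suc p} {f = λ m → f m ∘ suc} {g} n
        (λ j {d} sp → SP-deg (ℕₚ.+-suc p (j ℕ.+ d)) (rf (suc j) sp))
        (λ i i≤n → spg i (m≤n⇒m≤1+n i≤n))))

  D-raises : Raises 1 D
  D-raises j sp = SP-cong (λ m → sym (×-assoc-* j _ _)) (SP-× j (SP-e* (suc j) sp))

  SP-path : ∀ n → SP n (λ m → path m n)
  SP-path = <-rec _ λ where
    zero    _  → SP-1
    (suc n) ih → SP-cong (λ m → sym (path-rec m n)) (SP-+ (SP-e (suc n))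
      (SP-deg (≡.cong suc (ℕₚ.+-identityʳ n)) (SP-conv {1} {g = path} n D-raises (λ i i≤n → ih (s≤s i≤n)))))

  SP-tail : ∀ j a {q} {g : ℕ → ℕ → Carrier} → (∀ i → SP (q ℕ.+ i) (λ m → g m i)) →
            SP (suc (j ℕ.+ (a ℕ.+ q))) (λ m → tail m j (g m) a)
  SP-tail zero    a spg = SP-0
  SP-tail (suc j) a {q} {g} spg = SP-+
    (SP-deg (≡.cong suc (≡.trans (≡.cong (suc j ℕ.+ a ℕ.+_) (ℕₚ.+-identityʳ q)) (ℕₚ.+-assoc (suc j) a q)))
      (D-raises (suc j ℕ.+ a) (spg 0)))
    (SP-deg (≡.cong suc (≡.trans (≡.cong (j ℕ.+_) (ℕₚ.+-suc a q)) (ℕₚ.+-suc j (a ℕ.+ q))))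
      (SP-tail j a {suc q} {λ m → g m ∘ suc} (λ i → SP-deg (ℕₚ.+-suc q i) (spg (suc i)))))

  module _ (5<N : 5 < N) where

    private
      -- The largest case, e₄ e₁, has degree 5; this is the source of the bound 5 < N.
      hooks : ∀ m k → k < 4 → e m (suc k) * e m 1 ≈ e m (2 ℕ.+ k) + hook k m
      hooks m k k<4 = e*e₁ m k (ℕₚ.<-≤-trans (s<s (s<s k<4)) 5<N)

    SP-X₁ : SP 7 (λ m → X m 1)
    SP-X₁ = SP-cong (λ m → sym (X₁ m (hooks m)))
      (SP-+ (SP-+ (SP-e 7) (SP-e* 1 (SP-e 6)))
      (SP-+ (SP-+ (D-raises 6 (SP-path 0)) (SP-+ (D-raises 5 (SP-path 1)) (D-raises 3 (SP-path 3))))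
      (SP-+ (SP-e* 1 (SP-+ (D-raises 5 (SP-path 0)) (SP-+ (D-raises 4 (SP-path 1)) (D-raises 3 (SP-path 2)))))
      (SP-+ (SP-× 3 (SP-e* 5 (SP-e 2)))
      (SP-+ (SP-e* 4 (SP-e* 2 (SP-e 1)))
      (SP-+ (SP-e* 2 (SP-e* 2 (SP-e* 2 (SP-e 1))))
      (SP-+ (SP-e* 3 (SP-e* 2 (SP-e* 1 (SP-e 1))))
      (SP-+ (SP-× 3 (SP-e* 3 (SP-e* 2 (SP-hook 0))))
      (SP-+ (SP-× 8 (SP-e* 4 (SP-e 3)))
            (SP-× 10 (SP-e* 3 (SP-e* 3 (SP-e 1)))))))))))))

    SP-X : ∀ a → SP (6 ℕ.+ a) (λ m → X m a)
    SP-X = <-rec _ λ where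
      zero          _  → SP-cong (λ m → sym (X₀ m)) (SP-path 6)
      (suc zero)    _  → SP-X₁
      (suc (suc a)) ih → SP-cong (λ m → sym (X₂₊ m (hooks m) a))
        (SP-+ (SP-+ (SP-e (8 ℕ.+ a)) (SP-e* 1 (SP-e (7 ℕ.+ a))))
        (SP-+ (SP-+ (SP-deg (ℕₚ.+-comm (2 ℕ.+ a) 6) (SP-conv {1} {g = X} (suc a) D-raises (λ i i≤ → ih (s≤s i≤))))
                    (SP-× a (SP-deg (ℕₚ.+-comm (3 ℕ.+ a) 5) (SP-e* (3 ℕ.+ a) (SP-e* 1 (SP-path 4))))))
        (SP-+ (SP-deg (ℕₚ.+-comm (3 ℕ.+ a) 5) (SP-e* (3 ℕ.+ a)
                (SP-+ (SP-× 5 (SP-hook 3)) (SP-+ (SP-× 3 (SP-e* 2 (SP-hook 1))) (SP-× 4 (SP-e* 3 (SP-hook 0)))))))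
        (SP-+ (SP-deg (≡.cong (6 ℕ.+_) (ℕₚ.+-identityʳ (2 ℕ.+ a))) (SP-tail 5 (2 ℕ.+ a) {g = path} SP-path))
              (SP-deg (≡.cong (6 ℕ.+_) (ℕₚ.+-identityʳ (2 ℕ.+ a))) (SP-e* 1 (SP-tail 4 (2 ℕ.+ a) {g = path} SP-path)))))))

-- Semistandard tableaux

boundsHead : ℕ → List ℕ → Bool
boundsHead i []      = true
boundsHead i (j ∷ _) = i ≤ᵇ j

weaklyInc-∷ : ∀ i w → weaklyInc (i ∷ w) ≡ boundsHead i w ∧ weaklyInc w
weaklyInc-∷ i []      = ≡.refl
weaklyInc-∷ i (j ∷ w) = ≡.refl

boundsHead-++ : ∀ {i m} v k → i ≤ m → boundsHead i (v ++ replicate k m) ≡ boundsHead i v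
boundsHead-++ []      zero    i≤m = ≡.refl
boundsHead-++ []      (suc k) i≤m = ≤ᵇ-true i≤m
boundsHead-++ (j ∷ v) k       i≤m = ≡.refl

≤ᵇ≡<ᵇ : ∀ r l → (r ≤ᵇ l) ≡ (r <ᵇ suc l)
≤ᵇ≡<ᵇ zero    l = ≡.refl
≤ᵇ≡<ᵇ (suc r) l = ≡.refl

<ᵇ-true : ∀ {m n} → m < n → (m <ᵇ n) ≡ true
<ᵇ-true = ≤ᵇ-true

<ᵇ-false : ∀ {m n} → n ≤ m → (m <ᵇ n) ≡ false
<ᵇ-false n≤m = ≤ᵇ-false (s≤s n≤m)

strictBelow-[] : ∀ u → strictBelow u [] ≡ true
strictBelow-[] []      = ≡.refl
strictBelow-[] (_ ∷ _) = ≡.refl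

∧-swap : ∀ a b c → a ∧ (b ∧ c) ≡ b ∧ (a ∧ c)
∧-swap true  b     c = ≡.refl
∧-swap false true  c = ≡.refl
∧-swap false false c = ≡.refl

-- Nothing can stand below an m, so the whole lower row must fit under u, where its own m's are
-- automatically larger. The length hypothesis keeps `zip` from cutting off the lower row.
strictBelow-++ : ∀ {m} u j v i → All (_< m) u → All (_< m) v → length v ℕ.+ i ≤ length u ℕ.+ j →
  strictBelow (u ++ replicate j m) (v ++ replicate i m) ≡ (length v ℕ.+ i ≤ᵇ length u) ∧ strictBelow u v
strictBelow-++ [] j [] zero _ _ _ = strictBelow-[] (replicate j _)
strictBelow-++ {m} [] (suc j) [] (suc i) _ _ _ rewrite <ᵇ-false (≤-refl {m}) = ≡.refl
strictBelow-++ [] (suc j) (b ∷ v) i _ (b<m ∷ _) _ rewrite <ᵇ-false (<⇒≤ b<m) = ≡.refl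
strictBelow-++ (a ∷ u) j [] zero _ _ _ = ≡.refl
strictBelow-++ {m} (a ∷ u) j [] (suc i) (a<m ∷ u<) _ le
  rewrite <ᵇ-true a<m | strictBelow-++ u j [] i u< [] (s≤s⁻¹ le) | strictBelow-[] u = ≡.cong (_∧ true) (≤ᵇ≡<ᵇ i (length u))
strictBelow-++ (a ∷ u) j (b ∷ v) i (_ ∷ u<) (_ ∷ v<) le
  rewrite strictBelow-++ u j v i u< v< (s≤s⁻¹ le) | ≤ᵇ≡<ᵇ (length v ℕ.+ i) (length u) =
  ∧-swap (a <ᵇ b) (length v ℕ.+ i <ᵇ suc (length u)) (strictBelow u v)

-- The test q abstracts the row above, so that rows can be peeled off one at a time: after a row w
-- it becomes `strictBelow w`.
columnsFrom : (List ℕ → Bool) → List (List ℕ) → Bool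
columnsFrom q []      = true
columnsFrom q (w ∷ T) = q w ∧ columnsStrict (w ∷ T)

columns-∷ : ∀ u T → columnsStrict (u ∷ T) ≡ columnsFrom (strictBelow u) T
columns-∷ u []      = ≡.refl
columns-∷ u (w ∷ T) = ≡.refl

columns-true : ∀ T → columnsStrict T ≡ columnsFrom (λ _ → true) T
columns-true []      = ≡.refl
columns-true (w ∷ T) = ≡.refl

interlace-head : ∀ b λs ρ → interlace b λs ρ ≡ true → head₀ ρ ≤ head₀ λs
interlace-head b []       []      _  = z≤n
interlace-head b (l ∷ λs) (r ∷ ρ) eq = ≤ᵇ-sound (proj₁ (∧-true (r ≤ᵇ l) (proj₂ (∧-true (l ≤ᵇ b) eq))))

trim : List ℕ → List ℕ
trim []          = []
trim (zero ∷ _)  = []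
trim (suc l ∷ λs) = suc l ∷ trim λs

module SSYT {c ℓ} (R : CommutativeSemiring c ℓ)
  (+-cancelˡ : LeftCancellative (CommutativeSemiring._≈_ R) (CommutativeSemiring._+_ R))
  (x : ℕ → CommutativeSemiring.Carrier R) where
  open CommutativeSemiring R hiding (zero)
  open ListSum R
  open PathPolynomials R +-cancelˡ x
  open import Relation.Binary.Reasoning.Setoid setoid
  open import Algebra.Properties.Semiring.Exp semiring using (_^_; ^-congʳ; ^-homo-*)
  open import Algebra.Solver.Ring.NaturalCoefficients.Default R
    using (solve; _:*_; _:=_)

  tableaux : ℕ → List ℕ → Carrier
  tableaux m λs = ∑ (fillings m λs) (λ T → when (isSSYT T) (mono (concatRows T)))

  rows : ℕ → (List ℕ → Bool) → List ℕ → Carrier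
  rows m q []       = 1#
  rows m q (l ∷ λs) = ∑ (words m l) λ w →
    when (weaklyInc w) (when (q w) (mono w * rows m (strictBelow w) λs))

  private
    rearrange : ∀ p a q b {r} → when ((p ∧ a) ∧ (q ∧ b)) r ≈ when p (when q (when (a ∧ b) r))
    rearrange true  a     true  b = refl
    rearrange true  true  false b = refl
    rearrange true  false false b = refl
    rearrange false a     q     b = refl

  ∑-fillings : ∀ m q λs →
    ∑ (fillings m λs) (λ T → when (and (map weaklyInc T) ∧ columnsFrom q T) (mono (concatRows T))) ≈ rows m q λs
  ∑-fillings m q []       = +-identityʳ 1#
  ∑-fillings m q (l ∷ λs) = begin
    ∑ (fillings m (l ∷ λs)) (λ T → when (and (map weaklyInc T) ∧ columnsFrom q T) (mono (concatRows T)))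
      ≈⟨ trans (∑-concatMap (λ w → map (w ∷_) Ts) (words m l)) (∑-cong (words m l) λ w → ∑-map (w ∷_) Ts) ⟩
    ∑ (words m l) (λ w → ∑ Ts (λ T →
      when ((weaklyInc w ∧ and (map weaklyInc T)) ∧ (q w ∧ columnsStrict (w ∷ T))) (mono (w ++ concatRows T))))
      ≈⟨ ∑-cong (words m l) (λ w → ∑-cong Ts λ T → trans
           (rearrange (weaklyInc w) (and (map weaklyInc T)) (q w) (columnsStrict (w ∷ T)))
           (when-cong (weaklyInc w) λ _ → when-cong (q w) λ _ → trans
             (reflexive (≡.cong (λ b → when (and (map weaklyInc T) ∧ b) (mono (w ++ concatRows T))) (columns-∷ w T)))
             (trans (when-cong (ok w T) λ _ → mono-++ w (concatRows T)) (sym (*-when (ok w T)))))) ⟩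
    ∑ (words m l) (λ w → ∑ Ts (λ T →
      when (weaklyInc w) (when (q w) (mono w * when (ok w T) (mono (concatRows T))))))
      ≈⟨ ∑-cong (words m l) (λ w → trans (sym (when-∑ (weaklyInc w) Ts)) (when-cong (weaklyInc w) λ _ →
             trans (sym (when-∑ (q w) Ts)) (when-cong (q w) λ _ →
               trans (sym (*-∑ (mono w) Ts)) (*-congˡ (∑-fillings m (strictBelow w) λs))))) ⟩
    rows m q (l ∷ λs) ∎
    where
    Ts = fillings m λs
    ok : List ℕ → List (List ℕ) → Bool
    ok w T = and (map weaklyInc T) ∧ columnsFrom (strictBelow w) T

  tableaux≈rows : ∀ m λs → tableaux m λs ≈ rows m (λ _ → true) λs
  tableaux≈rows m λs = trans (∑-cong (fillings m λs) λ T → reflexive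
    (≡.cong (λ b → when (and (map weaklyInc T) ∧ b) (mono (concatRows T))) (columns-true T)))
    (∑-fillings m (λ _ → true) λs)

  ∑-inc-max : ∀ m l {f : List ℕ → Carrier} →
    ∑ (words (suc m) l) (λ w → when (weaklyInc (m ∷ w)) (f w)) ≈ f (replicate l m)
  ∑-inc-max m zero    = +-identityʳ _
  ∑-inc-max m (suc l) {f} = begin
    ∑ (words (suc m) (suc l)) (λ w → when (weaklyInc (m ∷ w)) (f w))
      ≈⟨ trans (∑-words (suc m) l) (∑<-last m) ⟩
    ∑< m (λ i → ∑ W (λ w → when ((m ≤ᵇ i) ∧ weaklyInc (i ∷ w)) (f (i ∷ w)))) +
    ∑ W (λ w → when ((m ≤ᵇ m) ∧ weaklyInc (m ∷ w)) (f (m ∷ w)))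
      ≈⟨ +-cong (trans (∑<-cong m λ i i<m → trans (∑-cong W λ w →
                   reflexive (≡.cong (λ b → when (b ∧ weaklyInc (i ∷ w)) (f (i ∷ w))) (≤ᵇ-false i<m))) (∑-0 W))
                   (∑-0 (upTo m)))
                (∑-cong W λ w →
                   reflexive (≡.cong (λ b → when (b ∧ weaklyInc (m ∷ w)) (f (m ∷ w))) (≤ᵇ-true (≤-refl {m})))) ⟩
    0# + ∑ W (λ w → when (weaklyInc (m ∷ w)) (f (m ∷ w)))
      ≈⟨ +-identityˡ _ ⟩
    ∑ W (λ w → when (weaklyInc (m ∷ w)) (f (m ∷ w)))
      ≈⟨ ∑-inc-max m l ⟩
    f (replicate (suc l) m) ∎
    where W = words (suc m) l

  -- The letters m of a weakly increasing word stand at its end; r counts the others.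
  ∑-inc-split : ∀ m l {f : List ℕ → Carrier} →
    ∑ (words (suc m) l) (λ w → when (weaklyInc w) (f w)) ≈
    ∑< (suc l) (λ r → ∑ (words m r) (λ v → when (weaklyInc v) (f (v ++ replicate (l ∸ r) m))))
  ∑-inc-split m zero    = sym (+-identityʳ _)
  ∑-inc-split m (suc l) {f} = begin
    ∑ (words (suc m) (suc l)) (λ w → when (weaklyInc w) (f w))
      ≈⟨ trans (∑-words (suc m) l) (∑<-last m) ⟩
    ∑< m (λ i → ∑ W (λ w → when (weaklyInc (i ∷ w)) (f (i ∷ w)))) +
    ∑ W (λ w → when (weaklyInc (m ∷ w)) (f (m ∷ w)))
      ≈⟨ +-cong (∑<-cong m (λ i i<m → small i (<⇒≤ i<m))) (∑-inc-max m l) ⟩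
    ∑< m (λ i → ∑< (suc l) (λ r → term i r)) + f (replicate (suc l) m)
      ≈⟨ trans (+-comm _ _) (+-cong (sym (+-identityʳ _)) (∑-swap (upTo m) (upTo (suc l)))) ⟩
    (f (replicate (suc l) m) + 0#) + ∑< (suc l) (λ r → ∑< m (λ i → term i r))
      ≈⟨ +-congˡ (∑-cong (upTo (suc l)) λ r → ∑-words m r) ⟨
    (f (replicate (suc l) m) + 0#) + ∑< (suc l) (λ r →
      ∑ (words m (suc r)) (λ v → when (weaklyInc v) (f (v ++ replicate (l ∸ r) m))))
      ≈⟨ ∑<-first (suc l) ⟨
    ∑< (suc (suc l)) (λ r → ∑ (words m r) (λ v → when (weaklyInc v) (f (v ++ replicate (suc l ∸ r) m)))) ∎
    where
    W = words (suc m) l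
    term : ℕ → ℕ → Carrier
    term i r = ∑ (words m r) (λ v → when (weaklyInc (i ∷ v)) (f (i ∷ v ++ replicate (l ∸ r) m)))
    split : ∀ i w {r} → when (weaklyInc (i ∷ w)) r ≈ when (weaklyInc w) (when (boundsHead i w) r)
    split i w = trans (reflexive (≡.cong (λ b → when b _) (weaklyInc-∷ i w)))
      (trans (when-∧ (boundsHead i w) (weaklyInc w)) (when-comm (boundsHead i w) (weaklyInc w)))
    small : ∀ i → i ≤ m → ∑ W (λ w → when (weaklyInc (i ∷ w)) (f (i ∷ w))) ≈ ∑< (suc l) (term i)
    small i i≤m = begin
      ∑ W (λ w → when (weaklyInc (i ∷ w)) (f (i ∷ w)))
        ≈⟨ ∑-cong W (λ w → split i w) ⟩
      ∑ W (λ w → when (weaklyInc w) (when (boundsHead i w) (f (i ∷ w))))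
        ≈⟨ ∑-inc-split m l ⟩
      ∑< (suc l) (λ r → ∑ (words m r) (λ v → when (weaklyInc v)
        (when (boundsHead i (v ++ replicate (l ∸ r) m)) (f (i ∷ v ++ replicate (l ∸ r) m)))))
        ≈⟨ ∑-cong (upTo (suc l)) (λ r → ∑-cong (words m r) λ v → trans
             (when-cong (weaklyInc v) λ _ → reflexive
               (≡.cong (λ b → when b (f (i ∷ v ++ replicate (l ∸ r) m))) (boundsHead-++ v (l ∸ r) i≤m)))
             (sym (split i v))) ⟩
      ∑< (suc l) (term i) ∎

  ∑<-truncate : ∀ {l n} {g : ℕ → Carrier} → l ≤ n → ∑< n (λ r → when (r <ᵇ l) (g r)) ≈ ∑< l g
  ∑<-truncate {n = n} z≤n = ∑-0 (upTo n)
  ∑<-truncate (s≤s {l} {n} l≤n) = trans (∑<-first n) (trans (+-congˡ (∑<-truncate l≤n)) (sym (∑<-first l)))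

  mono-replicate : ∀ k i → mono (replicate k i) ≈ x i ^ k
  mono-replicate zero    i = refl
  mono-replicate (suc k) i = *-congˡ (mono-replicate k i)

  rows-trim : ∀ m {b q} μ → Desc b μ → q [] ≡ true → rows m q (trim μ) ≈ rows m q μ
  rows-trim m []          _       _   = refl
  rows-trim m {q = q} (zero ∷ μ) (_ ∷ d) q[] = sym (rows-zeros {q} (zero ∷ μ) (z≤n ∷ d) q[])
    where
    rows-zeros : ∀ {q} μ → Desc 0 μ → q [] ≡ true → rows m q μ ≈ 1#
    rows-zeros []          _         _   = refl
    rows-zeros (zero ∷ μ)  (z≤n ∷ d) q[] = trans (+-identityʳ _) (trans (when-true q[])
      (trans (*-identityˡ _) (rows-zeros μ d ≡.refl)))
  rows-trim m (suc l ∷ μ) (_ ∷ d) q[] = ∑-cong (words m (suc l)) λ w →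
    when-cong (weaklyInc w) λ _ → when-cong _ λ _ → *-congˡ (rows-trim m μ d (strictBelow-[] w))

  module _ (N : ℕ) where
    open SchurPolynomials R +-cancelˡ x N using (s)

    branch : ℕ → ℕ → (List ℕ → Bool) → List ℕ → Carrier
    branch m p q λs = ∑ (words (suc N) (length λs)) λ ρ →
      when (interlace p λs ρ) (x m ^ (sum λs ∸ sum ρ) * rows m q ρ)

    -- Deleting all letters m from a tableau of shape λ leaves one of shape ρ with λ/ρ a horizontal
    -- strip. The condition from the row above splits accordingly: p is the number of its entries
    -- below m, which the current row may not exceed, and q′ compares what remains.
    rows-branch : ∀ m {p B q q′} λs → Desc B λs → B ≤ N →
      (∀ {l} v → l ≤ B → length v ≤ l → All (_< m) v →
         q (v ++ replicate (l ∸ length v) m) ≡ (l ≤ᵇ p) ∧ q′ v) →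
      rows (suc m) q λs ≈ branch m p q′ λs
    rows-branch m []       _  _ _ = sym (trans (+-identityʳ _) (*-identityˡ 1#))
    rows-branch m {p} {B} {q} {q′} (l ∷ λs) (l≤B ∷ d) B≤N q-split = begin
      rows (suc m) q (l ∷ λs)
        ≈⟨ ∑-inc-split m l ⟩
      ∑< (suc l) (λ r → ∑ (words m r) (λ v → when (weaklyInc v)
        (when (q (v ++ replicate (l ∸ r) m))
          (mono (v ++ replicate (l ∸ r) m) * rows (suc m) (strictBelow (v ++ replicate (l ∸ r) m)) λs))))
        ≈⟨ ∑<-cong (suc l) (λ r r<1+l → row r (s≤s⁻¹ r<1+l)) ⟩
      ∑< (suc l) (λ r → when (l ≤ᵇ p) (∑ W (λ ρ → when (interlace r λs ρ) (y r ρ * rows m q′ (r ∷ ρ)))))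
        ≈⟨ ∑<-truncate (s≤s (≤-trans l≤B B≤N)) ⟨
      ∑< (suc N) (λ r → when (r <ᵇ suc l) (when (l ≤ᵇ p)
        (∑ W (λ ρ → when (interlace r λs ρ) (y r ρ * rows m q′ (r ∷ ρ))))))
        ≈⟨ ∑-cong (upTo (suc N)) (λ r → begin
             when (r <ᵇ suc l) (when (l ≤ᵇ p) (∑ W (λ ρ → when (interlace r λs ρ) (y r ρ * rows m q′ (r ∷ ρ)))))
               ≈⟨ when-comm (r <ᵇ suc l) (l ≤ᵇ p) ⟩
             when (l ≤ᵇ p) (when (r <ᵇ suc l) (∑ W (λ ρ → when (interlace r λs ρ) (y r ρ * rows m q′ (r ∷ ρ)))))
               ≈⟨ when-cong (l ≤ᵇ p) (λ _ → when-≡ (≤ᵇ≡<ᵇ r l)) ⟨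
             when (l ≤ᵇ p) (when (r ≤ᵇ l) (∑ W (λ ρ → when (interlace r λs ρ) (y r ρ * rows m q′ (r ∷ ρ)))))
               ≈⟨ trans (when-cong (l ≤ᵇ p) λ _ → when-∑ (r ≤ᵇ l) W) (when-∑ (l ≤ᵇ p) W) ⟩
             ∑ W (λ ρ → when (l ≤ᵇ p) (when (r ≤ᵇ l) (when (interlace r λs ρ) (y r ρ * rows m q′ (r ∷ ρ)))))
               ≈⟨ ∑-cong W (λ ρ → trans (when-∧ (l ≤ᵇ p) _) (when-cong (l ≤ᵇ p) λ _ → when-∧ (r ≤ᵇ l) _)) ⟨
             ∑ W (λ ρ → when (interlace p (l ∷ λs) (r ∷ ρ)) (y r ρ * rows m q′ (r ∷ ρ))) ∎) ⟩
      ∑< (suc N) (λ r → ∑ W (λ ρ → when (interlace p (l ∷ λs) (r ∷ ρ)) (y r ρ * rows m q′ (r ∷ ρ))))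
        ≈⟨ ∑-words (suc N) (length λs) ⟨
      branch m p q′ (l ∷ λs) ∎
      where
      W = words (suc N) (length λs)
      y : ℕ → List ℕ → Carrier
      y r ρ = x m ^ ((l ℕ.+ sum λs) ∸ (r ℕ.+ sum ρ))
      z : List ℕ → List ℕ → Carrier
      z v ρ = mono v * rows m (strictBelow v) ρ
      degree : ∀ {r n k} → r ≤ l → n ≤ k → (l ℕ.+ k) ∸ (r ℕ.+ n) ≡ (l ∸ r) ℕ.+ (k ∸ n)
      degree {r} {n} {k} r≤l n≤k = ≡.trans (≡.sym (ℕₚ.∸-+-assoc (l ℕ.+ k) r n)) (≡.trans
        (≡.cong (_∸ n) (ℕₚ.+-∸-comm k r≤l)) (ℕₚ.+-∸-assoc (l ∸ r) n≤k))
      row : ∀ r → r ≤ l →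
        ∑ (words m r) (λ v → when (weaklyInc v)
          (when (q (v ++ replicate (l ∸ r) m))
            (mono (v ++ replicate (l ∸ r) m) * rows (suc m) (strictBelow (v ++ replicate (l ∸ r) m)) λs))) ≈
        when (l ≤ᵇ p) (∑ W (λ ρ → when (interlace r λs ρ) (y r ρ * rows m q′ (r ∷ ρ))))
      row r r≤l = begin
        ∑ (words m r) (λ v → when (weaklyInc v)
          (when (q (v ++ replicate (l ∸ r) m))
            (mono (v ++ replicate (l ∸ r) m) * rows (suc m) (strictBelow (v ++ replicate (l ∸ r) m)) λs)))
          ≈⟨ ∑-words-cong m r (λ { v ≡.refl v< → when-cong (weaklyInc v) λ _ → trans
               (reflexive (≡.cong (λ b → when b _) (q-split v l≤B r≤l v<)))
               (trans (when-∧ (l ≤ᵇ p) (q′ v)) (when-cong (l ≤ᵇ p) λ _ → when-cong (q′ v) λ _ → product v v< r≤l)) }) ⟩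
        ∑ (words m r) (λ v → when (weaklyInc v) (when (l ≤ᵇ p) (when (q′ v)
          (∑ W (λ ρ → when (interlace r λs ρ) (y r ρ * z v ρ))))))
          ≈⟨ trans (∑-cong (words m r) λ v → when-comm (weaklyInc v) (l ≤ᵇ p)) (sym (when-∑ (l ≤ᵇ p) (words m r))) ⟩
        when (l ≤ᵇ p) (∑ (words m r) (λ v → when (weaklyInc v) (when (q′ v)
          (∑ W (λ ρ → when (interlace r λs ρ) (y r ρ * z v ρ))))))
          ≈⟨ when-cong (l ≤ᵇ p) (λ _ → trans (∑-cong (words m r) λ v →
               trans (when-cong (weaklyInc v) λ _ → when-∑ (q′ v) W) (when-∑ (weaklyInc v) W))
               (∑-swap (words m r) W)) ⟩
        when (l ≤ᵇ p) (∑ W (λ ρ → ∑ (words m r) (λ v → when (weaklyInc v) (when (q′ v)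
          (when (interlace r λs ρ) (y r ρ * z v ρ))))))
          ≈⟨ when-cong (l ≤ᵇ p) (λ _ → ∑-cong W λ ρ → begin
               ∑ (words m r) (λ v → when (weaklyInc v) (when (q′ v) (when (interlace r λs ρ) (y r ρ * z v ρ))))
                 ≈⟨ ∑-cong (words m r) (λ v → trans
                      (when-cong (weaklyInc v) λ _ → when-comm (q′ v) (interlace r λs ρ))
                      (trans (when-comm (weaklyInc v) (interlace r λs ρ)) (when-cong (interlace r λs ρ) λ _ →
                        sym (trans (*-when (weaklyInc v)) (when-cong (weaklyInc v) λ _ → *-when (q′ v)))))) ⟩
               ∑ (words m r) (λ v → when (interlace r λs ρ) (y r ρ * when (weaklyInc v) (when (q′ v) (z v ρ))))
                 ≈⟨ trans (sym (when-∑ (interlace r λs ρ) (words m r)))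
                      (when-cong (interlace r λs ρ) λ _ → sym (*-∑ (y r ρ) (words m r))) ⟩
               when (interlace r λs ρ) (y r ρ * rows m q′ (r ∷ ρ)) ∎) ⟩
        when (l ≤ᵇ p) (∑ W (λ ρ → when (interlace r λs ρ) (y r ρ * rows m q′ (r ∷ ρ)))) ∎
        where
        product : ∀ v → All (_< m) v → length v ≤ l →
          mono (v ++ replicate (l ∸ length v) m) * rows (suc m) (strictBelow (v ++ replicate (l ∸ length v) m)) λs ≈
          ∑ W (λ ρ → when (interlace (length v) λs ρ) (y (length v) ρ * z v ρ))
        product v v< r≤l = begin
          mono (v ++ replicate k m) * rows (suc m) (strictBelow (v ++ replicate k m)) λs
            ≈⟨ *-cong (trans (mono-++ v (replicate k m)) (*-congˡ (mono-replicate k m)))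
                 (rows-branch m λs d (≤-trans l≤B B≤N) below) ⟩
          (mono v * x m ^ k) * branch m (length v) (strictBelow v) λs
            ≈⟨ *-∑ _ W ⟩
          ∑ W (λ ρ → (mono v * x m ^ k) * when (interlace (length v) λs ρ)
            (x m ^ (sum λs ∸ sum ρ) * rows m (strictBelow v) ρ))
            ≈⟨ ∑-cong W (λ ρ → trans (*-when (interlace (length v) λs ρ)) (when-cong (interlace (length v) λs ρ) λ eq →
                 trans (solve 4 (λ a b c e → a :* b :* (c :* e) := b :* c :* (a :* e)) refl _ _ _ _)
                 (*-congʳ (trans (sym (^-homo-* (x m) k (sum λs ∸ sum ρ)))
                   (^-congʳ (x m) (≡.sym (degree r≤l (interlace-sum (length v) λs ρ eq)))))))) ⟩
          ∑ W (λ ρ → when (interlace (length v) λs ρ) (y (length v) ρ * z v ρ)) ∎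
          where
          k = l ∸ length v
          -- For the next row, p is the length of v, the current row without its letters m.
          below : ∀ {l′} u → l′ ≤ l → length u ≤ l′ → All (_< m) u →
            strictBelow (v ++ replicate k m) (u ++ replicate (l′ ∸ length u) m) ≡ (l′ ≤ᵇ length v) ∧ strictBelow v u
          below {l′} u l′≤l |u|≤l′ u< = ≡.trans
            (strictBelow-++ v k u (l′ ∸ length u) v< u<
              (≡.subst₂ _≤_ (≡.sym (ℕₚ.m+[n∸m]≡n |u|≤l′)) (≡.sym (ℕₚ.m+[n∸m]≡n r≤l)) l′≤l))
            (≡.cong (λ n → (n ≤ᵇ length v) ∧ strictBelow v u) (ℕₚ.m+[n∸m]≡n |u|≤l′))

    rows≈s : ∀ m λs → Desc N λs → rows m (λ _ → true) λs ≈ s m λs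
    rows≈s zero    λs _ = go λs ≡.refl
      where
      go : ∀ {q} λs → q [] ≡ true → rows 0 q λs ≈ when (allZero λs) 1#
      go []           _   = refl
      go (zero ∷ λs)  q[] = trans (+-identityʳ _) (trans (when-true q[]) (trans (*-identityˡ _) (go λs ≡.refl)))
      go (suc l ∷ λs) q[] = refl
    rows≈s (suc m) λs d = trans
      -- No row lies above the first one; its bound N + 1 is satisfied because all parts are at most
      -- N.
      (rows-branch m λs d ≤-refl (λ v l≤N _ _ → ≡.cong (_∧ true) (≡.sym (≤ᵇ-true (m≤n⇒m≤1+n l≤N)))))
      (∑-cong (words (suc N) (length λs)) λ ρ → when-cong (interlace (suc N) λs ρ) λ eq →
        *-congˡ (rows≈s m ρ (rebound (≤-trans (interlace-head (suc N) λs ρ eq) (desc-head d))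
                                     (interlace-descʳ (suc N) λs ρ eq))))

    tableaux-trim≈s : ∀ m λs → Desc N λs → tableaux m (trim λs) ≈ s m λs
    tableaux-trim≈s m λs d = trans (tableaux≈rows m (trim λs)) (trans (rows-trim m λs d ≡.refl) (rows≈s m λs d))

-- Colourings of spiders

at-++ : ∀ pre v i → at (pre ++ v) (length pre ℕ.+ i) ≡ at v i
at-++ []        v i = ≡.refl
at-++ (_ ∷ pre) v i = at-++ pre v i

proper-++ : ∀ es {es′} w → proper (es ++ es′) w ≡ proper es w ∧ proper es′ w
proper-++ []       w = ≡.refl
proper-++ (e ∷ es) w = ≡.trans (≡.cong (_ ∧_) (proper-++ es w)) 
  (≡.sym (∧-assoc (not (at w (proj₁ e) ≡ᵇ at w (proj₂ e))) (proper es w) _))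

-- The colours `rest` after the leg let the hypotheses hold for every i, in range or not, so the
-- induction only shifts h.
proper-chain : ∀ (h : ℕ → ℕ & ℕ) w d u {rest} →
  (∀ i → at w (proj₁ (h i)) ≡ at (d ∷ u ++ rest) i) →
  (∀ i → at w (proj₂ (h i)) ≡ at (u ++ rest) i) →
  proper (applyUpTo h (length u)) w ≡ chain d u
proper-chain h w d []       _  _  = ≡.refl
proper-chain h w d (d′ ∷ u) h₁ h₂ = ≡.cong₂ _∧_
  (≡.cong₂ (λ a b → not (a ≡ᵇ b)) (h₁ 0) (h₂ 0))
  (proper-chain (h ∘ suc) w d′ u (h₁ ∘ suc) (h₂ ∘ suc))

proper-leg : ∀ c pre u rest →
  proper (legEdges (length pre) (length u)) (c ∷ pre ++ u ++ rest) ≡ chain c u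
proper-leg c pre []      rest = ≡.refl
proper-leg c pre (d ∷ u) rest = ≡.cong₂ _∧_
  (≡.cong (λ b → not (c ≡ᵇ b)) (at-leg 0))
  (≡.trans (≡.cong (λ es → proper es w) (map-applyUpTo suc _ (length u)))
           (proper-chain (λ i → (length pre ℕ.+ suc i , length pre ℕ.+ suc (suc i))) w d u
              at-leg (at-leg ∘ suc)))
  where
  w = c ∷ pre ++ d ∷ u ++ rest
  at-leg : ∀ i → at w (length pre ℕ.+ suc i) ≡ at (d ∷ u ++ rest) i
  at-leg i = ≡.trans (≡.cong (at w) (ℕₚ.+-suc (length pre) i)) (at-++ pre (d ∷ u ++ rest) i)

module SpiderPolynomials {c ℓ} (R : CommutativeSemiring c ℓ)
  (+-cancelˡ : LeftCancellative (CommutativeSemiring._≈_ R) (CommutativeSemiring._+_ R))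
  (x : ℕ → CommutativeSemiring.Carrier R) (m : ℕ) where
  open CommutativeSemiring R hiding (zero)
  open ListSum R
  open PathPolynomials R +-cancelˡ x
  open import Relation.Binary.Reasoning.Setoid setoid

  legs : ℕ → List ℕ → Carrier
  legs c = foldr (λ l r → leg m c l * r) 1#

  -- Legs meet only in the centre, so for a fixed centre colour c the sum factors over them. `pre`
  -- holds the colours of the o vertices of the legs already passed.
  spider-legs : ∀ c pre o ls → length pre ≡ o →
    ∑ (words m (sum ls)) (λ w → when (proper (spiderEdges o ls) (c ∷ pre ++ w)) (mono w)) ≈ legs c ls
  spider-legs c pre o []       _      = +-identityʳ _
  spider-legs c pre o (l ∷ ls) ≡.refl = begin
    ∑ (words m (l ℕ.+ sum ls)) (λ w → when (proper (legEdges o l ++ spiderEdges (o ℕ.+ l) ls) (c ∷ pre ++ w)) (mono w))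
      ≈⟨ ∑-words-++ m l (sum ls) ⟩
    ∑ (words m l) (λ u → ∑ (words m (sum ls)) (λ v →
      when (proper (legEdges o l ++ spiderEdges (o ℕ.+ l) ls) (c ∷ pre ++ u ++ v)) (mono (u ++ v))))
      ≈⟨ ∑-words-cong m l (λ { u ≡.refl _ → begin
           ∑ (words m (sum ls)) (λ v →
             when (proper (legEdges o l ++ spiderEdges (o ℕ.+ l) ls) (c ∷ pre ++ u ++ v)) (mono (u ++ v)))
             ≈⟨ ∑-cong (words m (sum ls)) (λ v → trans
                  (when-≡ (≡.trans (proper-++ (legEdges o l) (c ∷ pre ++ u ++ v)) (≡.cong₂ _∧_ (proper-leg c pre u v)
                    (≡.cong (λ w → proper (spiderEdges (o ℕ.+ l) ls) (c ∷ w)) (≡.sym (++-assoc pre u v))))))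
                  (trans (when-∧ (chain c u) (rest u v)) (when-cong (chain c u) λ _ →
                    trans (when-cong (rest u v) λ _ → mono-++ u v) (sym (*-when (rest u v)))))) ⟩
           ∑ (words m (sum ls)) (λ v → when (chain c u) (mono u * when (rest u v) (mono v)))
             ≈⟨ trans (sym (when-∑ (chain c u) (words m (sum ls))))
                  (when-cong (chain c u) λ _ → sym (*-∑ (mono u) (words m (sum ls)))) ⟩
           when (chain c u) (mono u * ∑ (words m (sum ls)) (λ v → when (rest u v) (mono v)))
             ≈⟨ when-cong (chain c u) (λ _ → *-congˡ (spider-legs c (pre ++ u) (o ℕ.+ l) ls (length-++ pre))) ⟩
           when (chain c u) (mono u * legs c ls)
             ≈⟨ when-cong (chain c u) (λ _ → *-comm _ _) ⟩
           when (chain c u) (legs c ls * mono u)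
             ≈⟨ trans (*-comm _ _) (*-when (chain c u)) ⟨
           when (chain c u) (mono u) * legs c ls ∎ }) ⟩
    ∑ (words m l) (λ u → when (chain c u) (mono u) * legs c ls)
      ≈⟨ ∑-* (words m l) (legs c ls) ⟨
    ∑ (words m l) (λ u → when (chain c u) (mono u)) * legs c ls
      ≈⟨ *-congʳ (leg-words m c l) ⟩
    legs c (l ∷ ls) ∎
    where
    rest : List ℕ → List ℕ → Bool
    rest u v = proper (spiderEdges (o ℕ.+ l) ls) (c ∷ (pre ++ u) ++ v)

  colorings : Graph → Carrier
  colorings G = ∑ (words m (size G)) (λ w → when (proper (edges G) w) (mono w))

  colorings-spider : ∀ ls → colorings (spider ls) ≈ ∑< m (λ c → x c * legs c ls)
  colorings-spider ls = trans (∑-words m (sum ls)) (∑-cong (upTo m) λ c → trans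
    (∑-cong (words m (sum ls)) λ w → sym (*-when (proper (spiderEdges 0 ls) (c ∷ w))))
    (trans (sym (*-∑ (x c) (words m (sum ls)))) (*-congˡ (spider-legs c [] 0 ls ≡.refl))))

  colorings-X : ∀ a → colorings (spider (a ∷ 4 ∷ 1 ∷ [])) ≈ X m a
  colorings-X a = trans (colorings-spider (a ∷ 4 ∷ 1 ∷ [])) (∑-cong (upTo m) λ c →
    *-congˡ (*-congˡ (*-congˡ (*-identityʳ _))))

-- Coefficients

open ListSum +-*-commutativeSemiring
open ≡.≡-Reasoning

content : (ℕ → ℕ) → List ℕ → List ℕ → Bool
content f []      w = true
content f (a ∷ α) w = (count (f 0) w ≡ᵇ a) ∧ content (f ∘ suc) α w

hasContent≡content : ∀ α w → hasContent α w ≡ content id α w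
hasContent≡content α w = go id α
  where
  go : ∀ f α → and (map (λ p → count (proj₁ p) w ≡ᵇ proj₂ p) (zip (applyUpTo f (length α)) α)) ≡ content f α w
  go f []      = ≡.refl
  go f (a ∷ α) = ≡.cong ((count (f 0) w ≡ᵇ a) ∧_) (go (f ∘ suc) α)

content-cong : ∀ f α {w w′} → (∀ i → count i w ≡ count i w′) → content f α w ≡ content f α w′
content-cong f []      eq = ≡.refl
content-cong f (a ∷ α) eq = ≡.cong₂ _∧_ (≡.cong (_≡ᵇ a) (eq (f 0))) (content-cong (f ∘ suc) α eq)

count-++ : ∀ i u v → count i (u ++ v) ≡ count i u ℕ.+ count i v
count-++ i []      v = ≡.refl
count-++ i (j ∷ u) v with j ≡ᵇ i
... | true  = ≡.cong suc (count-++ i u v)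
... | false = count-++ i u v

content-comm : ∀ α u v → content id α (u ++ v) ≡ content id α (v ++ u)
content-comm α u v = content-cong id α λ i →
  ≡.trans (count-++ i u v) (≡.trans (ℕₚ.+-comm (count i u) _) (≡.sym (count-++ i v u)))

-- Division of the monomial with exponents α by the word u: either the exponents β of the quotient,
-- or indivisibility.
Residual : (ℕ → ℕ) → List ℕ → List ℕ → Set
Residual f α u = (∃ λ β → ∀ v → content f α (u ++ v) ≡ content f β v) ⊎ (∀ v → content f α (u ++ v) ≡ false)

residual₁ : ∀ f α i → Residual f α [ i ]
residual₁ f []      i = inj₁ ([] , λ _ → ≡.refl)
residual₁ f (a ∷ α) i with residual₁ (f ∘ suc) α i
... | inj₂ eq = inj₂ λ v → ≡.trans (≡.cong (_ ∧_) (eq v)) (∧-zeroʳ _)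
... | inj₁ (β , eq) with i ≡ᵇ f 0
...   | false = inj₁ (a ∷ β , λ v → ≡.cong (_ ∧_) (eq v))
...   | true with a
...     | zero   = inj₂ λ v → ≡.refl
...     | suc a′ = inj₁ (a′ ∷ β , λ v → ≡.cong (_ ∧_) (eq v))

residual : ∀ α u → Residual id α u
residual α []      = inj₁ (α , λ _ → ≡.refl)
residual α (i ∷ u) with residual₁ id α i
... | inj₂ eq       = inj₂ λ v → eq (u ++ v)
... | inj₁ (β , eq) with residual β u
...   | inj₁ (γ , eq′) = inj₁ (γ , λ v → ≡.trans (eq (u ++ v)) (eq′ v))
...   | inj₂ eq′       = inj₂ λ v → ≡.trans (eq (u ++ v)) (eq′ v)

-- Polynomials with natural coefficients: a list of words is a sum of monomials, and a word
-- a product of variables.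
Poly : Set
Poly = List (List ℕ)

-- Letters beyond the length of α are ignored, as if those variables were 1. The final comparison
-- uses exactly `length α` variables, so nothing is lost there.
coeff : Poly → List ℕ → ℕ
coeff p α = ∑ p (λ w → when (content id α w) 1)

infix  4 _≈ᴾ_
infixl 7 _*ᴾ_

_≈ᴾ_ : Poly → Poly → Set
p ≈ᴾ q = ∀ α → coeff p α ≡ coeff q α

_*ᴾ_ : Poly → Poly → Poly
p *ᴾ q = concatMap (λ u → map (u ++_) q) p

∑-*ᴾ : ∀ p q {f : List ℕ → ℕ} → ∑ (p *ᴾ q) f ≡ ∑ p (λ u → ∑ q (λ v → f (u ++ v)))
∑-*ᴾ p q = ≡.trans (∑-concatMap (λ u → map (u ++_) q) p) (∑-cong p λ u → ∑-map (u ++_) q)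

coeff-++ : ∀ p q α → coeff (p ++ q) α ≡ coeff p α ℕ.+ coeff q α
coeff-++ p q α = ∑-++ p

-- For each word u of p, the coefficient of u q at α is 0 or a coefficient of q at the quotient of α
-- by u, and these agree for q and q′.
*ᴾ-congˡ : ∀ p {q q′} → q ≈ᴾ q′ → p *ᴾ q ≈ᴾ p *ᴾ q′
*ᴾ-congˡ p {q} {q′} q≈q′ α = ≡.trans (∑-*ᴾ p q) (≡.trans (∑-cong p by-residual) (≡.sym (∑-*ᴾ p q′)))
  where
  χ : Bool → ℕ
  χ b = when b 1
  by-residual : ∀ u → ∑ q (λ v → χ (content id α (u ++ v))) ≡ ∑ q′ (λ v → χ (content id α (u ++ v)))
  by-residual u with residual α u
  ... | inj₁ (β , eq) = ≡.trans (∑-cong q (≡.cong χ ∘ eq)) (≡.trans (q≈q′ β) (≡.sym (∑-cong q′ (≡.cong χ ∘ eq))))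
  ... | inj₂ eq       = ≡.trans (∑-cong q (≡.cong χ ∘ eq)) (≡.trans (∑-0 q)
                          (≡.sym (≡.trans (∑-cong q′ (≡.cong χ ∘ eq)) (∑-0 q′))))

*ᴾ-comm : ∀ p q → p *ᴾ q ≈ᴾ q *ᴾ p
*ᴾ-comm p q α = ≡.trans (∑-*ᴾ p q) (≡.trans (∑-swap p q) (≡.trans
  (∑-cong q λ v → ∑-cong p λ u → ≡.cong (λ b → when b 1) (content-comm α u v)) (≡.sym (∑-*ᴾ q p))))

*ᴾ-assoc : ∀ p q r → (p *ᴾ q) *ᴾ r ≈ᴾ p *ᴾ (q *ᴾ r)
*ᴾ-assoc p q r α = begin
  coeff ((p *ᴾ q) *ᴾ r) α
    ≡⟨ ≡.trans (∑-*ᴾ (p *ᴾ q) r) (∑-*ᴾ p q) ⟩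
  ∑ p (λ u → ∑ q (λ v → ∑ r (λ w → when (content id α ((u ++ v) ++ w)) 1)))
    ≡⟨ ∑-cong p (λ u → ∑-cong q λ v → ∑-cong r λ w → ≡.cong (λ y → when (content id α y) 1) (++-assoc u v w)) ⟩
  ∑ p (λ u → ∑ q (λ v → ∑ r (λ w → when (content id α (u ++ v ++ w)) 1)))
    ≡⟨ ≡.trans (∑-*ᴾ p (q *ᴾ r)) (∑-cong p λ u → ∑-*ᴾ q r) ⟨
  coeff (p *ᴾ (q *ᴾ r)) α ∎

polySemiring : CommutativeSemiring 0ℓ 0ℓ
polySemiring = record
  { Carrier = Poly
  ; _≈_     = _≈ᴾ_
  ; _+_     = _++_
  ; _*_     = _*ᴾ_
  ; 0#      = []
  ; 1#      = [ [] ]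
  ; isCommutativeSemiring = isCommutativeSemiringˡ record
    { +-isCommutativeMonoid = record
      { isMonoid = record
        { isSemigroup = record
          { isMagma = record
            { isEquivalence = isEquivalence
            ; ∙-cong        = λ {p} {p′} {q} {q′} p≈p′ q≈q′ α → ≡.trans (coeff-++ p q α)
                (≡.trans (≡.cong₂ ℕ._+_ (p≈p′ α) (q≈q′ α)) (≡.sym (coeff-++ p′ q′ α)))
            }
          ; assoc = λ p q r α → ≡.cong (λ y → coeff y α) (++-assoc p q r)
          }
        ; identity = (λ p α → ≡.refl) , (λ p α → ≡.cong (λ y → coeff y α) (++-identityʳ p))
        }
      ; comm = λ p q α → ≡.trans (coeff-++ p q α)
          (≡.trans (ℕₚ.+-comm (coeff p α) _) (≡.sym (coeff-++ q p α)))
      }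
    ; *-isCommutativeMonoid = record
      { isMonoid = record
        { isSemigroup = record
          { isMagma = record
            { isEquivalence = isEquivalence
            ; ∙-cong        = λ {p} {p′} {q} {q′} p≈p′ q≈q′ α → ≡.trans (*ᴾ-congˡ p q≈q′ α)
                (≡.trans (*ᴾ-comm p q′ α) (≡.trans (*ᴾ-congˡ q′ p≈p′ α) (*ᴾ-comm q′ p′ α)))
            }
          ; assoc = *ᴾ-assoc
          }
        ; identity = *-identityˡ , λ p α → ≡.trans (*ᴾ-comm p [ [] ] α) (*-identityˡ p α)
        }
      ; comm = *ᴾ-comm
      }
    ; distribʳ = λ p q r α → ≡.trans (∑-*ᴾ (q ++ r) p) (≡.trans (∑-++ q) (≡.sym
        (≡.trans (coeff-++ (q *ᴾ p) (r *ᴾ p) α) (≡.cong₂ ℕ._+_ (∑-*ᴾ q p) (∑-*ᴾ r p)))))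
    ; zeroˡ = λ p α → ≡.refl
    }
  }
  where
  isEquivalence : IsEquivalence _≈ᴾ_
  isEquivalence = record
    { refl = λ α → ≡.refl ; sym = λ eq α → ≡.sym (eq α) ; trans = λ eq eq′ α → ≡.trans (eq α) (eq′ α) }
  *-identityˡ : ∀ p → [ [] ] *ᴾ p ≈ᴾ p
  *-identityˡ p α = ≡.trans (∑-*ᴾ [ [] ] p) (ℕₚ.+-identityʳ (coeff p α))

++-cancelˡ : ∀ p q r → p ++ q ≈ᴾ p ++ r → q ≈ᴾ r
++-cancelˡ p q r eq α = ℕₚ.+-cancelˡ-≡ (coeff p α) _ _
  (≡.trans (≡.sym (coeff-++ p q α)) (≡.trans (eq α) (coeff-++ p r α)))

var : ℕ → Poly
var i = [ [ i ] ]

module P = ListSum polySemiring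
open PathPolynomials polySemiring ++-cancelˡ var using (mono; X)
open SpiderPolynomials polySemiring ++-cancelˡ var using (colorings; colorings-X)
open SSYT polySemiring ++-cancelˡ var using (tableaux; tableaux-trim≈s)

mono≡ : ∀ w → mono w ≡ [ w ]
mono≡ []      = ≡.refl
mono≡ (i ∷ w) rewrite mono≡ w = ≡.refl

coeff-∑ : ∀ {A : Set} (as : List A) {f : A → Poly} α → coeff (P.∑ as f) α ≡ ∑ as (λ a → coeff (f a) α)
coeff-∑ []       α = ≡.refl
coeff-∑ (a ∷ as) {f} α = ≡.trans (coeff-++ (f a) (P.∑ as f) α) (≡.cong (coeff (f a) α ℕ.+_) (coeff-∑ as α))

coeff-when-mono : ∀ b w α → coeff (P.when b (mono w)) α ≡ when (b ∧ hasContent α w) 1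
coeff-when-mono true  w α rewrite mono≡ w | hasContent≡content α w = ℕₚ.+-identityʳ _
coeff-when-mono false w α = ≡.refl

length-filter : ∀ {A : Set} (p : A → Bool) as → length (filterᵇ p as) ≡ ∑ as (λ a → when (p a) 1)
length-filter p []       = ≡.refl
length-filter p (a ∷ as) with p a
... | true  = ≡.cong suc (length-filter p as)
... | false = length-filter p as

chromCoeff≡coeff : ∀ G α → chromCoeff G α ≡ coeff (colorings (length α) G) α
chromCoeff≡coeff G α = ≡.trans (length-filter _ ws) (≡.sym (≡.trans (coeff-∑ ws α)
  (∑-cong ws λ w → coeff-when-mono (proper (edges G) w) w α)))
  where ws = words (length α) (size G)

kostka≡coeff : ∀ λs α → kostka λs α ≡ coeff (tableaux (length α) λs) α
kostka≡coeff λs α = ≡.trans (length-filter _ Ts) (≡.sym (≡.trans (coeff-∑ Ts α)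
  (∑-cong Ts λ T → coeff-when-mono (isSSYT T) (concatRows T) α)))
  where Ts = fillings (length α) λs

-- Multiplicities over the list of partitions

_≡ᴸ_ : List ℕ → List ℕ → Bool
[]       ≡ᴸ []       = true
(a ∷ as) ≡ᴸ (b ∷ bs) = (a ≡ᵇ b) ∧ (as ≡ᴸ bs)
_        ≡ᴸ _        = false

∑<-point : ∀ {i n} {h : ℕ → ℕ} → i < n → ∑< n (λ j → when (i ≡ᵇ j) (h j)) ≡ h i
∑<-point {zero}  {suc n} {h} _   = ≡.trans (∑<-first n) (≡.trans (≡.cong (h 0 ℕ.+_) (∑-0 (upTo n))) (ℕₚ.+-identityʳ _))
∑<-point {suc i} {suc n} {h} i<n =
  ≡.trans (∑<-first n {λ j → when (suc i ≡ᵇ j) (h j)}) (∑<-point (s<s⁻¹ i<n))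

-- Every admissible partition is listed exactly once, phrased as evaluation at a point so that it
-- collapses sums. The induction follows the first part, suc j in the enumeration.
∑-partsF : ∀ f n k λs {g : List ℕ → ℕ} → Desc k λs → All (0 <_) λs → sum λs ≡ n → n ≤ f →
           ∑ (partsF f n k) (λ μ → when (λs ≡ᴸ μ) (g μ)) ≡ g λs
∑-partsF f       zero    k []           _         _        _    _   = ℕₚ.+-identityʳ _
∑-partsF f       zero    k (zero ∷ λs)  _         (() ∷ _) _    _
∑-partsF f       zero    k (suc l ∷ λs) _         _        ()   _
∑-partsF (suc f) (suc n) k (suc l ∷ λs) {g} (l<k ∷ d) (_ ∷ 0<) Σλ (s≤s n≤f) = begin
  ∑ (partsF (suc f) (suc n) k) (λ μ → when ((suc l ∷ λs) ≡ᴸ μ) (g μ))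
    ≡⟨ ∑-concatMap (λ j → map (suc j ∷_) (parts j)) (filterᵇ (_<ᵇ k) (upTo (suc n))) ⟩
  ∑ (filterᵇ (_<ᵇ k) (upTo (suc n))) (λ j → ∑ (map (suc j ∷_) (parts j)) (λ μ → when ((suc l ∷ λs) ≡ᴸ μ) (g μ)))
    ≡⟨ ∑-filter (_<ᵇ k) (upTo (suc n)) ⟩
  ∑< (suc n) (λ j → when (j <ᵇ k) (∑ (map (suc j ∷_) (parts j)) (λ μ → when ((suc l ∷ λs) ≡ᴸ μ) (g μ))))
    ≡⟨ ∑-cong (upTo (suc n)) (λ j → begin
         when (j <ᵇ k) (∑ (map (suc j ∷_) (parts j)) (λ μ → when ((suc l ∷ λs) ≡ᴸ μ) (g μ)))
           ≡⟨ ≡.cong (when (j <ᵇ k)) (≡.trans (∑-map (suc j ∷_) (parts j)) (≡.trans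
                (∑-cong (parts j) λ μ → when-∧ (l ≡ᵇ j) (λs ≡ᴸ μ)) (≡.sym (when-∑ (l ≡ᵇ j) (parts j))))) ⟩
         when (j <ᵇ k) (when (l ≡ᵇ j) (∑ (parts j) (λ μ → when (λs ≡ᴸ μ) (g (suc j ∷ μ)))))
           ≡⟨ when-comm (j <ᵇ k) (l ≡ᵇ j) ⟩
         when (l ≡ᵇ j) (when (j <ᵇ k) (∑ (parts j) (λ μ → when (λs ≡ᴸ μ) (g (suc j ∷ μ))))) ∎) ⟩
  ∑< (suc n) (λ j → when (l ≡ᵇ j) (when (j <ᵇ k) (∑ (parts j) (λ μ → when (λs ≡ᴸ μ) (g (suc j ∷ μ))))))
    ≡⟨ ∑<-point (s≤s (≡.subst (l ≤_) (ℕₚ.suc-injective Σλ) (ℕₚ.m≤m+n l (sum λs)))) ⟩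
  when (l <ᵇ k) (∑ (parts l) (λ μ → when (λs ≡ᴸ μ) (g (suc l ∷ μ))))
    ≡⟨ when-true (<ᵇ-true l<k) ⟩
  ∑ (parts l) (λ μ → when (λs ≡ᴸ μ) (g (suc l ∷ μ)))
    ≡⟨ ∑-partsF f (n ∸ l) (suc l) λs d 0<
         (≡.trans (≡.sym (ℕₚ.m+n∸m≡n l (sum λs))) (≡.cong (_∸ l) (ℕₚ.suc-injective Σλ)))
         (≤-trans (ℕₚ.m∸n≤m n l) n≤f) ⟩
  g (suc l ∷ λs) ∎
  where
  parts : ℕ → List (List ℕ)
  parts j = partsF f (n ∸ j) (suc j)

trim-desc : ∀ {b} μ → Desc b μ → Desc b (trim μ)
trim-desc []          _         = []
trim-desc (zero ∷ μ)  _         = []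
trim-desc (suc l ∷ μ) (l≤b ∷ d) = l≤b ∷ trim-desc μ d

trim-positive : ∀ μ → All (0 <_) (trim μ)
trim-positive []          = []
trim-positive (zero ∷ μ)  = []
trim-positive (suc l ∷ μ) = z<s ∷ trim-positive μ

trim-sum : ∀ {b} μ → Desc b μ → sum (trim μ) ≡ sum μ
trim-sum []          _       = ≡.refl
trim-sum (zero ∷ μ)  (_ ∷ d) = ≡.sym (zeros d)
  where
  zeros : ∀ {μ} → Desc 0 μ → sum μ ≡ 0
  zeros []        = ≡.refl
  zeros (z≤n ∷ d) = zeros d
trim-sum (suc l ∷ μ) (_ ∷ d) = ≡.cong (suc l ℕ.+_) (trim-sum μ d)

∑-partitions : ∀ {n b} μ {g : List ℕ → ℕ} → Desc b μ → sum μ ≡ n →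
               ∑ (partitions n) (λ λs → when (trim μ ≡ᴸ λs) (g λs)) ≡ g (trim μ)
∑-partitions {n} μ d Σμ = ∑-partsF n n n (trim μ)
  (rebound (head≤ (trim μ) (≡.trans (trim-sum μ d) Σμ)) (trim-desc μ d))
  (trim-positive μ) (≡.trans (trim-sum μ d) Σμ) ≤-refl
  where
  head≤ : ∀ λs → sum λs ≡ n → head₀ λs ≤ n
  head≤ []       _  = z≤n
  head≤ (l ∷ λs) Σλ = ≡.subst (l ≤_) Σλ (ℕₚ.m≤m+n l (sum λs))

sum-map≡∑ : ∀ {A : Set} (f : A → ℕ) as → sum (map f as) ≡ ∑ as f
sum-map≡∑ f []       = ≡.refl
sum-map≡∑ f (a ∷ as) = ≡.cong (f a ℕ.+_) (sum-map≡∑ f as)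

-- The Schur coefficients. Shapes in Λ are padded with zeros while `partitions` lists positive parts
-- only, hence `trim`.
multiplicity : List (List ℕ) → List ℕ → ℕ
multiplicity Λ λs = ∑ Λ (λ μ → when (trim μ ≡ᴸ λs) 1)

kostka-expansion : ∀ {n b} Λ α → All (λ μ → Desc b μ & (sum μ ≡ n)) Λ →
  sum (map (λ λs → multiplicity Λ λs ℕ.* kostka λs α) (partitions n)) ≡ ∑ Λ (λ μ → kostka (trim μ) α)
kostka-expansion {n} Λ α all = begin
  sum (map (λ λs → multiplicity Λ λs ℕ.* kostka λs α) (partitions n))
    ≡⟨ sum-map≡∑ _ (partitions n) ⟩
  ∑ (partitions n) (λ λs → multiplicity Λ λs ℕ.* kostka λs α)
    ≡⟨ ∑-cong (partitions n) (λ λs → ≡.trans (∑-* Λ (kostka λs α)) (∑-cong Λ λ μ → when-1* (trim μ ≡ᴸ λs))) ⟩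
  ∑ (partitions n) (λ λs → ∑ Λ (λ μ → when (trim μ ≡ᴸ λs) (kostka λs α)))
    ≡⟨ ∑-swap (partitions n) Λ ⟩
  ∑ Λ (λ μ → ∑ (partitions n) (λ λs → when (trim μ ≡ᴸ λs) (kostka λs α)))
    ≡⟨ ∑-All all (λ { μ (d , Σμ) → ∑-partitions μ d Σμ }) ⟩
  ∑ Λ (λ μ → kostka (trim μ) α) ∎
  where
  when-1* : ∀ b {k} → when b 1 ℕ.* k ≡ when b k
  when-1* true  = ℕₚ.*-identityˡ _
  when-1* false = ≡.refl

theorem4p6 : (a : ℕ) → 4 ≤ a → SchurPositive (spider (a ∷ 4 ∷ 1 ∷ []))
-- The spider has a + 6 vertices, so N = a + 7 is the least number of rows exceeding the degree.
theorem4p6 a _ with SP-X (ℕₚ.m≤m+n 6 (suc a)) a ≤-refl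
  where open SchurCone polySemiring ++-cancelˡ var (6 ℕ.+ a)
... | Λ , all , eq = multiplicity Λ , λ α _ → begin
  chromCoeff G α
    ≡⟨ chromCoeff≡coeff G α ⟩
  coeff (colorings (length α) G) α
    ≡⟨ colorings-X (length α) a α ⟩
  coeff (X (length α) a) α
    ≡⟨ eq (length α) α ⟩
  coeff (P.∑ Λ (s (length α))) α
    ≡⟨ coeff-∑ Λ α ⟩
  ∑ Λ (λ μ → coeff (s (length α) μ) α)
    ≡⟨ ∑-All all (λ { μ (d , _ , Σμ) → ≡.trans (kostka≡coeff (trim μ) α)
         (tableaux-trim≈s (7 ℕ.+ a) (length α) μ (rebound (head≤ μ Σμ) d) α) }) ⟨
  ∑ Λ (λ μ → kostka (trim μ) α)
    ≡⟨ kostka-expansion Λ α (All.map (λ { (d , _ , Σμ) → d , ≡.trans Σμ (≡.cong suc (ℕₚ.+-comm 5 a)) }) all) ⟨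
  sum (map (λ λs → multiplicity Λ λs ℕ.* kostka λs α) (partitions (size G))) ∎
  where
  open SchurPolynomials polySemiring ++-cancelˡ var (7 ℕ.+ a) using (s)
  G : Graph
  G = spider (a ∷ 4 ∷ 1 ∷ [])
  head≤ : ∀ μ → sum μ ≡ 6 ℕ.+ a → head₀ μ ≤ 7 ℕ.+ a
  head≤ []      _  = z≤n
  head≤ (r ∷ μ) Σμ = ≤-trans (ℕₚ.m≤m+n r (sum μ)) (≤-trans (ℕₚ.≤-reflexive Σμ) (ℕₚ.n≤1+n _))
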